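{- Let $k\geq 3$ be an integer and let $D$ be a $k$-dicritical oriented graph. Then \[ m(D) \geq \left( k - \frac{3}{4}-\frac{1}{4k-6}\right) n(D) + \frac{3}{4(2k-3)}. \]
   Context: Digraphs are finite, have no loops and no parallel arcs; two opposite arcs are allowed. For a digraph $D$, $n(D)$ is its number of vertices and $m(D)$ its number of arcs. An oriented graph is a digraph with no pair of opposite arcs. A subdigraph $D'$ of $D$ satisfies $V(D')\subseteq V(D)$, $A(D')\subseteq A(D)$; it is proper if $V(D')\neq V(D)$ or $A(D')\neq A(D)$. A $k$-dicolouring of a digraph is a colouring of its vertices with colours in $\{1,\dots,k\}$ such that each colour class induces an acyclic subdigraph. The dichromatic number $\vec{\chi}(D)$ is the least $k$ such that $D$ has a $k$-dicolouring. $D$ is $k$-dicritical if $\vec{\chi}(D)=k$ and $\vec{\chi}(D')<k$ for every proper subdigraph $D'$ of $D$. -}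

module Defs where

open import Data.Fin using (Fin; combine; remQuot)
open import Data.Fin.Properties using (remQuot-combine)
open import Data.Fin.Subset using (Subset; _∈_; _⊆_; _∩_; ∣_∣)
open import Data.Fin.Subset.Properties using (_∈?_; x∈p∩q⁺)
open import Data.Integer using (+_)
open import Data.List using (List; []; _∷_; _∷ʳ_)
open import Data.List.Relation.Unary.Linked using (Linked)
open import Data.List.Relation.Unary.Unique.Propositional using (Unique)
open import Data.Nat using (ℕ; _*_; _∸_; _≤_; _<_; _≟_; NonZero; >-nonZero; s≤s; z≤n)
open import Data.Nat.Properties using (m<n⇒0<n∸m; *-monoʳ-≤; ≤-trans; m*n≢0)
open import Data.Product using (Σ-syntax; ∃-syntax; _×_; _,_; proj₁; proj₂)
open import Data.Rational using (ℚ; _/_)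
open import Data.Sum using (_⊎_)
open import Data.Vec using (tabulate)
open import Data.Vec.Properties using ([]=⇒lookup; lookup∘tabulate)
open import Level using (Level)
open import Relation.Binary.PropositionalEquality using (_≡_; _≢_; sym; trans; subst)
open import Relation.Nullary using (¬_; does; yes; no; _×-dec_)
open import Relation.Unary using (Pred; Decidable)

private
  variable
    N : ℕ
    ℓ : Level

subset : {P : Pred (Fin N) ℓ} → Decidable P → Subset N
subset P? = tabulate (λ i → does (P? i))

∈-subset⁻ : {P : Pred (Fin N) ℓ} (P? : Decidable P) {i : Fin N} → i ∈ subset P? → P i
∈-subset⁻ P? {i} i∈ with P? i | trans (sym (lookup∘tabulate (λ j → does (P? j)) i)) ([]=⇒lookup i∈)
... | yes p | _  = p
... | no  _ | ()

-- The vertices are drawn from the universe Fin N without having to fill it, so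
-- that a digraph and all its subdigraphs are values of one type. The arc from
-- u to v is encoded as the index combine u v, combine being a bijection from
-- Fin N × Fin N to Fin (N * N).
record Digraph (N : ℕ) : Set where
  field
    V : Subset N
    A : Subset (N * N)

  infix 4 _⟶_
  _⟶_ : Fin N → Fin N → Set
  u ⟶ v = combine u v ∈ A

  field
    ends     : ∀ {u v} → u ⟶ v → u ∈ V × v ∈ V
    loopless : ∀ {v} → ¬ v ⟶ v

  n m : ℕ
  n = ∣ V ∣
  m = ∣ A ∣

open Digraph public using (n; m)

Oriented : Digraph N → Set
Oriented D = ∀ {u v} → u ⟶ v → ¬ v ⟶ u
  where open Digraph D

_IsSubdigraphOf_ : Digraph N → Digraph N → Set
D′ IsSubdigraphOf D = D′.V ⊆ D.V × D′.A ⊆ D.A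
  where
  module D′ = Digraph D′
  module D  = Digraph D

_IsProperSubdigraphOf_ : Digraph N → Digraph N → Set
D′ IsProperSubdigraphOf D = D′ IsSubdigraphOf D × (D′.V ≢ D.V ⊎ D′.A ≢ D.A)
  where
  module D′ = Digraph D′
  module D  = Digraph D

-- S need not be contained in the vertex set: only its vertices in D matter.
induced : Digraph N → Subset N → Digraph N
induced {N} D S = record
  { V        = V ∩ S
  ; A        = subset inside?
  ; ends     = λ e →
      let (a , u∈S , v∈S) = inside⁻ e
          (u∈V , v∈V)     = ends a
      in x∈p∩q⁺ (u∈V , u∈S) , x∈p∩q⁺ (v∈V , v∈S)
  ; loopless = λ e → loopless (proj₁ (inside⁻ e))
  }
  where
  open Digraph D

  Inside : Fin (N * N) → Set
  Inside e = e ∈ A × proj₁ (remQuot {N} N e) ∈ S × proj₂ (remQuot {N} N e) ∈ S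

  inside? : Decidable Inside
  inside? e = (e ∈? A) ×-dec ((proj₁ (remQuot {N} N e) ∈? S) ×-dec (proj₂ (remQuot {N} N e) ∈? S))

  inside⁻ : ∀ {u v} → combine u v ∈ subset inside? → u ⟶ v × u ∈ S × v ∈ S
  inside⁻ {u} {v} e with ∈-subset⁻ inside? e
  ... | a , u∈S , v∈S =
    a , subst (λ p → proj₁ p ∈ S) (remQuot-combine u v) u∈S
      , subst (λ p → proj₂ p ∈ S) (remQuot-combine u v) v∈S

-- The cycle v ⟶ v₁ ⟶ … ⟶ vₗ ⟶ v is listed as v and v₁ ∷ … ∷ vₗ. The case
-- l = 0 would be a loop, which a digraph does not have.
DirectedCycle : Digraph N → Fin N → List (Fin N) → Set
DirectedCycle D v vs = Unique (v ∷ vs) × Linked _⟶_ (v ∷ vs ∷ʳ v)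
  where open Digraph D

Acyclic : Digraph N → Set
Acyclic D = ∀ v vs → ¬ DirectedCycle D v vs

colourClass : (Fin N → ℕ) → ℕ → Subset N
colourClass c i = subset (λ v → c v ≟ i)

-- The values of c outside the vertex set of D are irrelevant.
record IsDicolouring (D : Digraph N) (k : ℕ) (c : Fin N → ℕ) : Set where
  field
    range   : ∀ {v} → v ∈ Digraph.V D → 1 ≤ c v × c v ≤ k
    acyclic : ∀ i → Acyclic (induced D (colourClass c i))

Dicolourable : Digraph N → ℕ → Set
Dicolourable {N} D k = Σ[ c ∈ (Fin N → ℕ) ] IsDicolouring D k c

-- A relation rather than a function: k is the least number of colours.
χ⃗_≡_ : Digraph N → ℕ → Set
χ⃗ D ≡ k = Dicolourable D k × (∀ j → Dicolourable D j → k ≤ j)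

Dicritical : ℕ → Digraph N → Set
Dicritical {N} k D =
  χ⃗ D ≡ k × (∀ (D′ : Digraph N) → D′ IsProperSubdigraphOf D → ∃[ j ] χ⃗ D′ ≡ j × j < k)

fromℕ : ℕ → ℚ
fromℕ a = + a / 1

4k∸6-nonZero : ∀ {k} → 3 ≤ k → NonZero (4 * k ∸ 6)
4k∸6-nonZero 3≤k = >-nonZero (m<n⇒0<n∸m (≤-trans 7≤12 (*-monoʳ-≤ 4 3≤k)))
  where
  7≤12 : 7 ≤ 12
  7≤12 = s≤s (s≤s (s≤s (s≤s (s≤s (s≤s (s≤s z≤n))))))

4[2k∸3]-nonZero : ∀ {k} → 3 ≤ k → NonZero (4 * (2 * k ∸ 3))
4[2k∸3]-nonZero {k} 3≤k = m*n≢0 4 (2 * k ∸ 3)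
  where
  4≤6 : 4 ≤ 6
  4≤6 = s≤s (s≤s (s≤s (s≤s z≤n)))
  instance
    2k∸3-nonZero : NonZero (2 * k ∸ 3)
    2k∸3-nonZero = >-nonZero (m<n⇒0<n∸m (≤-trans 4≤6 (*-monoʳ-≤ 2 3≤k)))

module Submission where

-- Write K = k - 1. Every vertex of D has at least K out-neighbours and at least
-- K in-neighbours; call it low if both numbers are exactly K. Let S be the set
-- of low vertices, s its size and e the number of arcs inside S. Three estimates
-- are combined linearly.
--
--   * A vertex that is not low has total degree at least 2K + 1, so the degree
--     sum gives (2K + 1) n <= 2 m + s (degree-bound).
--   * Each low vertex has total degree 2K, and only the arcs inside S are
--     counted twice, so 2K s <= m + e (low-degree-bound).
--   * If S is not empty, then 2 e <= 3 (s - 1) (low-forest). If S is empty, the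
--     first estimate suffices.
--
-- The third estimate is the main point. It holds since in the graph underlying
-- D[S] each edge is on at most one cycle, and the cycles are directed, hence of
-- length at least 3. This is Gallai's theorem on the low vertices; the part of
-- it that is needed is proved in two halves.
--
-- Recolouring (low-NoFork). By criticality D - h has a K-dicolouring for each
-- vertex h, the hole. No colouring of D - h extends to D, so each of the K
-- colours occurs among the out-neighbours of h and among its in-neighbours; if
-- h is low, it occurs exactly once in each. Therefore the hole can be moved to
-- any neighbour u of h, by giving h the colour of u. Suppose that a low vertex v
-- has two out-neighbours (or two in-neighbours) joined by a walk of low vertices
-- avoiding v, and let the walk be as short as possible. It closes up to a cycle
-- c 0 = v, c 1, c 2, ..., indexed with period L, and the hole is pushed around
-- this cycle, so that it is at c t at time t. Let x t be the colour of the next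
-- vertex c (t + 1) at time t. When the hole is at h = c (t + 1), the vertex behind
-- it has colour x t and the vertex ahead has colour x (t + 1). The colour x t
-- must still occur, after a full turn, among the neighbours of h on the same
-- side (out or in) as the vertex behind. Colours off the cycle do not change in
-- a turn, and a chord at h would give a shorter walk; so either
-- x (t + 1) = x t, or the vertex ahead is on the same side as the vertex behind
-- and x (t + 2) = x t (turn). As the two neighbours of v on the cycle are on the
-- same side, their colours differ. This excludes the first case all the way
-- round: the vertices of the cycle are alternately sources and sinks of the
-- cycle, and x takes alternately two values. After a full turn v is of the same
-- kind as before, but x, whose period is L - 1, takes the other value.
--
-- Counting (fork-free-bound). Let T be a nonempty set. If no vertex v of T has two out-neighbours, or two
-- in-neighbours, in the same component of T - v, then T spans at most
-- 3 (|T| - 1) / 2 arcs, by induction on |T|. Such a component contains at most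
-- two neighbours of v. Let v have a neighbour a. Either T - v is disconnected and
-- T splits into two parts that share v; or v has at most one neighbour b besides
-- a. In the latter case let a a' be the first edge of a simple walk from a to b
-- in T - v. It is a bridge of T - v: if the part of a' in T - v - a contained a
-- second neighbour y of a, then a', y and v would be three neighbours of a in one
-- component of T - a. Removing v and a a' leaves two parts and costs three arcs.

open import Defs
open import Data.Bool using (Bool; true; false; _∧_; not)
import Data.Bool.Properties as Bool
open import Data.Empty using (⊥; ⊥-elim)
open import Data.Fin using (Fin; zero; suc; combine; remQuot; toℕ; _↑ˡ_; _↑ʳ_)
import Data.Fin.Properties as Fin
open import Data.Fin.Subset using (Subset; _∈_; ∣_∣)
import Data.Fin.Subset.Properties as Subset
open import Data.List using (List; []; _∷_; _∷ʳ_; length)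
open import Data.List.Membership.Propositional using () renaming (_∈_ to _∈ₗ_)
open import Data.List.Relation.Unary.All as All using (All; []; _∷_)
import Data.List.Relation.Unary.All.Properties as All
open import Data.List.Relation.Unary.Any as Any using (here; there)
open import Data.List.Relation.Unary.Linked as Linked using (Linked; []; [-]; _∷_)
open import Data.List.Relation.Unary.Unique.Propositional using (Unique)
open import Data.Nat as ℕ using (ℕ; zero; suc; z≤n; s≤s; _∸_; _%_; NonZero)
import Data.Nat.DivMod as ℕ
import Data.Nat.Properties as ℕ
open import Algebra.Properties.CommutativeMonoid.Sum ℕ.+-0-commutativeMonoid
  using (sum; sum-cong-≗; ∑-distrib-+; ∑-comm; sum-replicate-zero)
open import Data.Nat.Tactic.RingSolver using (solve-∀)
open import Data.Product using (_×_; _,_; proj₁; proj₂; swap; ∃-syntax)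
open import Data.Sum using (_⊎_; inj₁; inj₂)
open import Data.Vec using (lookup; []; _∷_)
import Data.Vec.Properties as Vec
open import Effect.Monad using (RawMonad)
open import Function using (case_of_)
open import Relation.Binary.Definitions using (tri<; tri≈; tri>)
open import Relation.Binary.PropositionalEquality
open import Relation.Nullary using (¬_; Dec; yes; no; does; ¬?)
open import Relation.Nullary.Decidable using (dec-true; dec-false; decidable-stable; ¬¬-excluded-middle; _×-dec_)
open import Relation.Nullary.Negation using (¬¬-Monad)
open import Relation.Unary using (Decidable)

-- Finite sums and sizes of sets

module FiniteSums where
  open import Data.Nat using (_+_; _*_; _≤_; _<_)

  infixl 7 _─_
  infixl 6 _∖_

  true-or-false : ∀ b → b ≡ true ⊎ b ≡ false
  true-or-false true  = inj₁ refl
  true-or-false false = inj₂ refl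

  -- The number 1 or 0 that a truth value contributes to a count.
  ⟦_⟧ : Bool → ℕ
  ⟦ true ⟧  = 1
  ⟦ false ⟧ = 0

  does⇒ : ∀ {ℓ} {P : Set ℓ} (d : Dec P) → does d ≡ true → P
  does⇒ (yes p) _ = p

  sum-mono : ∀ {N} {f g : Fin N → ℕ} → (∀ i → f i ≤ g i) → sum f ≤ sum g
  sum-mono {zero}  f≤g = z≤n
  sum-mono {suc N} f≤g = ℕ.+-mono-≤ (f≤g zero) (sum-mono (λ i → f≤g (suc i)))

  sum-*ˡ : ∀ {N} c (f : Fin N → ℕ) → sum (λ i → c * f i) ≡ c * sum f
  sum-*ˡ {zero}  c f = sym (ℕ.*-zeroʳ c)
  sum-*ˡ {suc N} c f = trans (cong (c * f zero +_) (sum-*ˡ c (λ i → f (suc i))))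
                             (sym (ℕ.*-distribˡ-+ c (f zero) _))

  sum-zero : ∀ {N} {f : Fin N → ℕ} → (∀ i → f i ≡ 0) → sum f ≡ 0
  sum-zero {N} f≡0 = trans (sum-cong-≗ f≡0) (sum-replicate-zero N)

  sum-↑ : ∀ m {n} (f : Fin (m + n) → ℕ) →
          sum f ≡ sum (λ i → f (i ↑ˡ n)) + sum (λ j → f (m ↑ʳ j))
  sum-↑ zero    f = refl
  sum-↑ (suc m) f = trans (cong (f zero +_) (sum-↑ m (λ i → f (suc i)))) (sym (ℕ.+-assoc (f zero) _ _))

  sum-combine : ∀ {m n} (f : Fin (m * n) → ℕ) →
                sum f ≡ sum (λ (i : Fin m) → sum (λ (j : Fin n) → f (combine i j)))
  sum-combine {zero}      f = refl
  sum-combine {suc m} {n} f = trans (sum-↑ n f)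
    (cong (sum (λ j → f (j ↑ˡ (m * n))) +_) (sum-combine {m} (λ e → f (n ↑ʳ e))))

  -- Sets of vertices are Boolean predicates; T ∖ C and T ─ v are the set
  -- differences with a set and with a single vertex.
  card : ∀ {N} → (Fin N → Bool) → ℕ
  card T = sum (λ i → ⟦ T i ⟧)

  _∖_ : ∀ {N} → (Fin N → Bool) → (Fin N → Bool) → Fin N → Bool
  (T ∖ C) x = T x ∧ not (C x)

  _─_ : ∀ {N} → (Fin N → Bool) → Fin N → Fin N → Bool
  (T ─ v) x = T x ∧ not (does (x Fin.≟ v))

  -- The indicator function of the singleton of v.
  δ : ∀ {N} → Fin N → Fin N → ℕ
  δ v x = ⟦ does (x Fin.≟ v) ⟧

  sum-δ : ∀ {N} (v : Fin N) → sum (δ v) ≡ 1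
  sum-δ {suc N} zero    = cong suc (sum-zero {N} (λ _ → refl))
  sum-δ {suc N} (suc v) = trans (sum-cong-≗ {N} shift) (sum-δ v)
    where
    shift : ∀ i → δ (suc v) (suc i) ≡ δ v i
    shift i with i Fin.≟ v
    ... | yes _ = refl
    ... | no  _ = refl

  δ-refl : ∀ {N} (v : Fin N) → δ v v ≡ 1
  δ-refl v = cong ⟦_⟧ (dec-true (v Fin.≟ v) refl)

  card-∖ : ∀ {N} (T : Fin N → Bool) {C} → (∀ x → C x ≡ true → T x ≡ true) →
           card C + card (T ∖ C) ≡ card T
  card-∖ T {C} C⊆T = trans (sym (∑-distrib-+ (λ i → ⟦ C i ⟧) _)) (sum-cong-≗ pointwise)
    where
    pointwise : ∀ x → ⟦ C x ⟧ + ⟦ (T ∖ C) x ⟧ ≡ ⟦ T x ⟧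
    pointwise x with C x | T x | C⊆T x
    ... | true  | true  | _ = refl
    ... | true  | false | h = case h refl of λ ()
    ... | false | true  | _ = refl
    ... | false | false | _ = refl

  card-─ : ∀ {N} (T : Fin N → Bool) {v} → T v ≡ true → suc (card (T ─ v)) ≡ card T
  card-─ T {v} Tv = trans (cong (_+ card (T ─ v)) (sym (sum-δ v)))
    (card-∖ T (λ x → ⊆ x (x Fin.≟ v)))
    where
    ⊆ : ∀ x (d : Dec (x ≡ v)) → does d ≡ true → T x ≡ true
    ⊆ x (yes refl) _ = Tv

  card-pos : ∀ {N} (T : Fin N → Bool) {v} → T v ≡ true → 0 < card T
  card-pos T Tv = subst (0 <_) (card-─ T Tv) (s≤s z≤n)

  ∈∖⁻ : ∀ {N} (T C : Fin N → Bool) {x} → (T ∖ C) x ≡ true → T x ≡ true × C x ≡ false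
  ∈∖⁻ T C {x} e with T x | C x
  ... | true | false = refl , refl

  ∈∖⁺ : ∀ {N} (T C : Fin N → Bool) {x} → T x ≡ true → C x ≡ false → (T ∖ C) x ≡ true
  ∈∖⁺ T C p q rewrite p | q = refl

  ∈─⁻ : ∀ {N} (T : Fin N → Bool) {v x} → (T ─ v) x ≡ true → T x ≡ true × x ≢ v
  ∈─⁻ T {v} {x} e with T x | x Fin.≟ v
  ... | true | no x≢v = refl , x≢v

  ∈─⁺ : ∀ {N} (T : Fin N → Bool) {v x} → T x ≡ true → x ≢ v → (T ─ v) x ≡ true
  ∈─⁺ T {v} {x} p x≢v rewrite p | dec-false (x Fin.≟ v) x≢v = refl

  injection⇒≤card : ∀ {K N} (P : Fin N → Bool) (g : Fin K → Fin N) →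
                    (∀ i → P (g i) ≡ true) → (∀ i j → g i ≡ g j → i ≡ j) → K ≤ card P
  injection⇒≤card {zero}  P g Pg inj = z≤n
  injection⇒≤card {suc K} P g Pg inj = subst (suc K ≤_) (card-─ P (Pg zero))
    (s≤s (injection⇒≤card (P ─ g zero) (λ i → g (suc i))
      (λ i → ∈─⁺ P (Pg (suc i)) (λ e → Fin.0≢1+n (sym (inj (suc i) zero e))))
      (λ i j e → Fin.suc-injective (inj (suc i) (suc j) e))))

  -- Reachability is not decided here by an algorithm. All conclusions drawn from
  -- it are inequalities between natural numbers, which are stable under double
  -- negation, so that a predicate on a finite set may be assumed decidable.
  ¬¬-decide : ∀ {N} (P : Fin N → Set) → ¬ ¬ (∀ i → Dec (P i))
  ¬¬-decide P = Fin.sequence (RawMonad.rawApplicative ¬¬-Monad) (λ i → ¬¬-excluded-middle)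

  ∣∣≡card : ∀ {N} (S : Subset N) → ∣ S ∣ ≡ card (lookup S)
  ∣∣≡card []          = refl
  ∣∣≡card (true ∷ S)  = cong suc (∣∣≡card S)
  ∣∣≡card (false ∷ S) = ∣∣≡card S

open FiniteSums

-- Arithmetic of the bounds

module Arithmetic where
  open import Data.Nat using (_+_; _*_; _≤_; _<_)

  -- The cases of the induction for fork-free sets. A set of t vertices and e
  -- arcs is cut into parts of t₁ and t₂ vertices with e₁ and e₂ arcs; the last
  -- summand in the bound on e is the number of arcs in neither part, and a
  -- summand 0 before it stands for an empty second part.
  arith-weak : ∀ {e e₁ t t₁} → suc t₁ ≡ t → e ≤ e₁ + 0 + 0 → 2 * e₁ ≤ 3 * t₁ → 3 + 2 * e ≤ 3 * t
  arith-weak {e} {e₁} {t₁ = t₁} refl e≤ b = begin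
    3 + 2 * e            ≤⟨ ℕ.+-monoʳ-≤ 3 (ℕ.*-monoʳ-≤ 2 e≤) ⟩
    3 + 2 * (e₁ + 0 + 0) ≡⟨ lemma₁ e₁ ⟩
    3 + 2 * e₁           ≤⟨ ℕ.+-monoʳ-≤ 3 b ⟩
    3 + 3 * t₁           ≡⟨ lemma₂ t₁ ⟩
    3 * suc t₁           ∎
    where
    open ℕ.≤-Reasoning
    lemma₁ : ∀ e₁ → 3 + 2 * (e₁ + 0 + 0) ≡ 3 + 2 * e₁
    lemma₁ = solve-∀
    lemma₂ : ∀ t₁ → 3 + 3 * t₁ ≡ 3 * suc t₁
    lemma₂ = solve-∀

  arith-leaf : ∀ {e e₁ t t₁} → suc t₁ ≡ t → e ≤ e₁ + 0 + 1 → 3 + 2 * e₁ ≤ 3 * t₁ → 3 + 2 * e ≤ 3 * t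
  arith-leaf {e} {e₁} {t₁ = t₁} refl e≤ b = begin
    3 + 2 * e            ≤⟨ ℕ.+-monoʳ-≤ 3 (ℕ.*-monoʳ-≤ 2 e≤) ⟩
    3 + 2 * (e₁ + 0 + 1) ≡⟨ lemma₁ e₁ ⟩
    (3 + 2 * e₁) + 2     ≤⟨ ℕ.+-mono-≤ b (ℕ.n≤1+n 2) ⟩
    3 * t₁ + 3           ≡⟨ lemma₂ t₁ ⟩
    3 * suc t₁           ∎
    where
    open ℕ.≤-Reasoning
    lemma₁ : ∀ e₁ → 3 + 2 * (e₁ + 0 + 1) ≡ (3 + 2 * e₁) + 2
    lemma₁ = solve-∀
    lemma₂ : ∀ t₁ → 3 * t₁ + 3 ≡ 3 * suc t₁
    lemma₂ = solve-∀

  arith-cut : ∀ {e e₁ e₂ t t₁ t₂} → t₁ + t₂ ≡ suc t → e ≤ e₁ + e₂ + 0 →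
              3 + 2 * e₁ ≤ 3 * t₁ → 3 + 2 * e₂ ≤ 3 * t₂ → 3 + 2 * e ≤ 3 * t
  arith-cut {e} {e₁} {e₂} {t} {t₁} {t₂} eq e≤ b₁ b₂ = ℕ.+-cancelˡ-≤ 3 _ _ (begin
    3 + (3 + 2 * e)                 ≤⟨ ℕ.+-monoʳ-≤ 3 (ℕ.+-monoʳ-≤ 3 (ℕ.*-monoʳ-≤ 2 e≤)) ⟩
    3 + (3 + 2 * (e₁ + e₂ + 0))     ≡⟨ lemma₁ e₁ e₂ ⟩
    (3 + 2 * e₁) + (3 + 2 * e₂)     ≤⟨ ℕ.+-mono-≤ b₁ b₂ ⟩
    3 * t₁ + 3 * t₂                 ≡⟨ ℕ.*-distribˡ-+ 3 t₁ t₂ ⟨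
    3 * (t₁ + t₂)                   ≡⟨ cong (3 *_) eq ⟩
    3 * suc t                       ≡⟨ ℕ.*-suc 3 t ⟩
    3 + 3 * t                       ∎)
    where
    open ℕ.≤-Reasoning
    lemma₁ : ∀ e₁ e₂ → 3 + (3 + 2 * (e₁ + e₂ + 0)) ≡ (3 + 2 * e₁) + (3 + 2 * e₂)
    lemma₁ = solve-∀

  arith-cycle : ∀ {e e₁ e₂ t t₁ t₂} → suc (t₁ + t₂) ≡ t → e ≤ e₁ + e₂ + 3 →
                3 + 2 * e₁ ≤ 3 * t₁ → 3 + 2 * e₂ ≤ 3 * t₂ → 3 + 2 * e ≤ 3 * t
  arith-cycle {e} {e₁} {e₂} {t₁ = t₁} {t₂} refl e≤ b₁ b₂ = begin
    3 + 2 * e                       ≤⟨ ℕ.+-monoʳ-≤ 3 (ℕ.*-monoʳ-≤ 2 e≤) ⟩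
    3 + 2 * (e₁ + e₂ + 3)           ≡⟨ lemma₁ e₁ e₂ ⟩
    3 + ((3 + 2 * e₁) + (3 + 2 * e₂)) ≤⟨ ℕ.+-monoʳ-≤ 3 (ℕ.+-mono-≤ b₁ b₂) ⟩
    3 + (3 * t₁ + 3 * t₂)           ≡⟨ lemma₂ t₁ t₂ ⟩
    3 * suc (t₁ + t₂)               ∎
    where
    open ℕ.≤-Reasoning
    lemma₁ : ∀ e₁ e₂ → 3 + 2 * (e₁ + e₂ + 3) ≡ 3 + ((3 + 2 * e₁) + (3 + 2 * e₂))
    lemma₁ = solve-∀
    lemma₂ : ∀ t₁ t₂ → 3 + (3 * t₁ + 3 * t₂) ≡ 3 * suc (t₁ + t₂)
    lemma₂ = solve-∀

  -- The two estimates for n vertices, m arcs, s low vertices and e arcs between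
  -- low vertices, for k = 3 + j. The case s = 0 is separate because the bound on
  -- e fails for the empty set.
  combine-bounds : ∀ j {n m s e} → 0 < n → (5 + 2 * j) * n ≤ 2 * m + s → (4 + 2 * j) * s ≤ m + e →
    s ≡ 0 ⊎ 3 + 2 * e ≤ 3 * s → (5 + 4 * j) * (5 + 2 * j) * n + 3 ≤ (12 + 8 * j) * m
  combine-bounds j {n} {m} 0<n deg _ (inj₁ refl) = begin
    (5 + 4 * j) * (5 + 2 * j) * n + 3               ≤⟨ ℕ.+-monoʳ-≤ ((5 + 4 * j) * (5 + 2 * j) * n) three ⟩
    (5 + 4 * j) * (5 + 2 * j) * n + (5 + 2 * j) * n ≡⟨ regroup j n ⟩
    (6 + 4 * j) * ((5 + 2 * j) * n)                 ≤⟨ ℕ.*-monoʳ-≤ (6 + 4 * j) deg ⟩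
    (6 + 4 * j) * (2 * m + 0)                       ≡⟨ double j m ⟩
    (12 + 8 * j) * m                                ∎
    where
    open ℕ.≤-Reasoning
    three : 3 ≤ (5 + 2 * j) * n
    three = ℕ.≤-trans (s≤s (s≤s (s≤s z≤n))) (ℕ.m≤m*n (5 + 2 * j) n {{ℕ.>-nonZero 0<n}})
    regroup : ∀ j n → (5 + 4 * j) * (5 + 2 * j) * n + (5 + 2 * j) * n ≡ (6 + 4 * j) * ((5 + 2 * j) * n)
    regroup = solve-∀
    double : ∀ j m → (6 + 4 * j) * (2 * m + 0) ≡ (12 + 8 * j) * m
    double = solve-∀
  combine-bounds j {n} {m} {s} {e} _ deg low (inj₂ forest) = begin
    (5 + 4 * j) * (5 + 2 * j) * n + 3           ≡⟨ cong (_+ 3) (ℕ.*-assoc (5 + 4 * j) (5 + 2 * j) n) ⟩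
    (5 + 4 * j) * ((5 + 2 * j) * n) + 3         ≤⟨ ℕ.+-monoˡ-≤ 3 (ℕ.*-monoʳ-≤ (5 + 4 * j) deg) ⟩
    (5 + 4 * j) * (2 * m + s) + 3               ≡⟨ split j m s ⟩
    (5 + 4 * j) * (2 * m) + ((5 + 4 * j) * s + 3) ≤⟨ ℕ.+-monoʳ-≤ ((5 + 4 * j) * (2 * m)) low-arcs ⟩
    (5 + 4 * j) * (2 * m) + 2 * m               ≡⟨ double j m ⟩
    (12 + 8 * j) * m                            ∎
    where
    open ℕ.≤-Reasoning
    split : ∀ j m s → (5 + 4 * j) * (2 * m + s) + 3 ≡ (5 + 4 * j) * (2 * m) + ((5 + 4 * j) * s + 3)
    split = solve-∀
    double : ∀ j m → (5 + 4 * j) * (2 * m) + 2 * m ≡ (12 + 8 * j) * m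
    double = solve-∀
    lemma₁ : ∀ j s e → 3 * s + 2 * e + ((5 + 4 * j) * s + 3) ≡ 2 * ((4 + 2 * j) * s) + (3 + 2 * e)
    lemma₁ = solve-∀
    lemma₂ : ∀ m e s → 2 * (m + e) + 3 * s ≡ 3 * s + 2 * e + 2 * m
    lemma₂ = solve-∀
    low-arcs : (5 + 4 * j) * s + 3 ≤ 2 * m
    low-arcs = ℕ.+-cancelˡ-≤ (3 * s + 2 * e) _ _ (begin
      3 * s + 2 * e + ((5 + 4 * j) * s + 3)  ≡⟨ lemma₁ j s e ⟩
      2 * ((4 + 2 * j) * s) + (3 + 2 * e)    ≤⟨ ℕ.+-mono-≤ (ℕ.*-monoʳ-≤ 2 low) forest ⟩
      2 * (m + e) + 3 * s                    ≡⟨ lemma₂ m e s ⟩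
      3 * s + 2 * e + 2 * m                  ∎)

open Arithmetic

-- Residues

module Residues where
  open import Data.Nat using (_+_; _≤_; _<_)

  %-shift : ∀ k t L .{{_ : NonZero L}} → (k + t) % L ≡ (k + t % L) % L
  %-shift k t L = begin
    (k + t) % L                 ≡⟨ ℕ.%-distribˡ-+ k t L ⟩
    (k % L + t % L) % L         ≡⟨ cong (λ r → (k % L + r) % L) (ℕ.m%n%n≡m%n t L) ⟨
    (k % L + t % L % L) % L     ≡⟨ ℕ.%-distribˡ-+ k (t % L) L ⟨
    (k + t % L) % L             ∎
    where open ≡-Reasoning

  -- Adding k with 0 < k < L changes the residue modulo L.
  %-moves : ∀ k t L .{{_ : NonZero L}} → 0 < k → k < L → (k + t) % L ≢ t % L
  %-moves k t L 0<k k<L eq with k + t % L ℕ.<? L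
  ... | yes small = ℕ.m+1+n≢m (t % L) {ℕ.pred k} (begin
    t % L + suc (ℕ.pred k) ≡⟨ cong (t % L +_) (ℕ.suc-pred k {{ℕ.>-nonZero 0<k}}) ⟩
    t % L + k              ≡⟨ ℕ.+-comm (t % L) k ⟩
    k + t % L              ≡⟨ ℕ.m<n⇒m%n≡m small ⟨
    (k + t % L) % L        ≡⟨ %-shift k t L ⟨
    (k + t) % L            ≡⟨ eq ⟩
    t % L                  ∎)
    where open ≡-Reasoning
  ... | no ¬small = ℕ.<⇒≢ k<L (ℕ.+-cancelʳ-≡ (t % L) k L (begin
    k + t % L                    ≡⟨ ℕ.m+[n∸m]≡n L≤ ⟨
    L + (k + t % L ∸ L)          ≡⟨ cong (L +_) (ℕ.m<n⇒m%n≡m reduced) ⟨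
    L + (k + t % L ∸ L) % L      ≡⟨ cong (L +_) (ℕ.m≤n⇒[n∸m]%m≡n%m L≤) ⟩
    L + (k + t % L) % L          ≡⟨ cong (L +_) (%-shift k t L) ⟨
    L + (k + t) % L              ≡⟨ cong (L +_) eq ⟩
    L + t % L                    ∎))
    where
    open ≡-Reasoning
    L≤ : L ≤ k + t % L
    L≤ = ℕ.≮⇒≥ ¬small
    reduced : k + t % L ∸ L < L
    reduced = ℕ.+-cancelˡ-< L _ _ (subst (_< L + L) (sym (ℕ.m+[n∸m]≡n L≤)) (ℕ.+-mono-< k<L (ℕ.m%n<n t L)))

open Residues

-- Walks and fork-free graphs

module Graph {N : ℕ} (arc : Fin N → Fin N → Bool) where
  open import Data.Nat using (_+_; _*_; _≤_; _<_)

  -- The Boolean is the side: true for out-neighbours, false for in-neighbours.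
  -- Thus Arc d x y says that y is a neighbour of x on the side d.
  arcs : Bool → Fin N → Fin N → Bool
  arcs true  x y = arc x y
  arcs false x y = arc y x

  Arc : Bool → Fin N → Fin N → Set
  Arc d x y = arcs d x y ≡ true

  Adj : Fin N → Fin N → Set
  Adj x y = ∃[ d ] Arc d x y

  Arc-flip : ∀ d {x y} → Arc d x y → Arc (not d) y x
  Arc-flip true  e = e
  Arc-flip false e = e

  Adj-sym : ∀ {x y} → Adj x y → Adj y x
  Adj-sym (d , e) = not d , Arc-flip d e

  -- A walk of the given number of steps in the underlying undirected graph, all
  -- of whose vertices lie in U.
  data Walk (U : Fin N → Bool) : ℕ → Fin N → Fin N → Set where
    here : ∀ {a} → U a ≡ true → Walk U 0 a a
    step : ∀ {n a x b} → U a ≡ true → Adj a x → Walk U n x b → Walk U (suc n) a b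

  Walk-mono : ∀ {U U′ n a b} → (∀ x → U x ≡ true → U′ x ≡ true) → Walk U n a b → Walk U′ n a b
  Walk-mono U⊆U′ (here u)     = here (U⊆U′ _ u)
  Walk-mono U⊆U′ (step u e w) = step (U⊆U′ _ u) e (Walk-mono U⊆U′ w)

  start∈ : ∀ {U n a b} → Walk U n a b → U a ≡ true
  start∈ (here u)     = u
  start∈ (step u _ _) = u

  end∈ : ∀ {U n a b} → Walk U n a b → U b ≡ true
  end∈ (here u)     = u
  end∈ (step _ _ w) = end∈ w

  snoc : ∀ {U n a b c} → Walk U n a b → Adj b c → U c ≡ true → Walk U (suc n) a c
  snoc (here u)     e v = step u e (here v)
  snoc (step u f w) e v = step u f (snoc w e v)

  _++_ : ∀ {U m n a b c} → Walk U m a b → Walk U n b c → Walk U (m + n) a c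
  here _     ++ w′ = w′
  step u e w ++ w′ = step u e (w ++ w′)

  reverse : ∀ {U n a b} → Walk U n a b → Walk U n b a
  reverse (here u)     = here u
  reverse (step u e w) = snoc (reverse w) (Adj-sym e) u

  -- The part of a walk after its last visit to its start a.
  final-exit : ∀ {U n a b} → a ≢ b → Walk U n a b →
               ∃[ a′ ] Adj a a′ × (∃[ m ] Walk (U ─ a) m a′ b)
  final-exit {U} {a = a} {b} a≢b w with go w
    where
    go : ∀ {n x} → Walk U n x b →
         (∃[ m ] Walk (U ─ a) m x b) ⊎ (∃[ a′ ] Adj a a′ × (∃[ m ] Walk (U ─ a) m a′ b))
    go (here u) = inj₁ (0 , here (∈─⁺ U u (λ e → a≢b (sym e))))
    go (step {a = x} u e w) with go w | x Fin.≟ a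
    ... | inj₂ r       | _        = inj₂ r
    ... | inj₁ (m , w) | yes refl = inj₂ (_ , e , m , w)
    ... | inj₁ (m , w) | no x≢a   = inj₁ (suc m , step (∈─⁺ U u x≢a) e w)
  ... | inj₁ (m , w) = ⊥-elim (proj₂ (∈─⁻ U (start∈ w)) refl)
  ... | inj₂ r       = r

  -- The vertex reached after the given number of steps, the last vertex if there
  -- are fewer steps.
  at : ∀ {U n a b} → Walk U n a b → ℕ → Fin N
  at (here {a} _)       _       = a
  at (step {a = a} _ _ _) zero    = a
  at (step _ _ w)       (suc i) = at w i

  at-start : ∀ {U n a b} (w : Walk U n a b) → at w 0 ≡ a
  at-start (here _)     = refl
  at-start (step _ _ _) = refl

  at-end : ∀ {U n a b} (w : Walk U n a b) → at w n ≡ b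
  at-end (here _)     = refl
  at-end (step _ _ w) = at-end w

  at∈ : ∀ {U n a b} (w : Walk U n a b) i → U (at w i) ≡ true
  at∈ (here u)     _       = u
  at∈ (step u _ _) zero    = u
  at∈ (step _ _ w) (suc i) = at∈ w i

  at-adjacent : ∀ {U n a b} (w : Walk U n a b) {i} → i < n → Adj (at w i) (at w (suc i))
  at-adjacent (step _ e w) {zero}  _         = subst (Adj _) (sym (at-start w)) e
  at-adjacent (step _ _ w) {suc i} (s≤s i<n) = at-adjacent w i<n

  take : ∀ {U n a b} (w : Walk U n a b) {i} → i ≤ n → Walk U i a (at w i)
  take w@(here u)     z≤n       = w
  take (step u _ _)   z≤n       = here u
  take (step u e w)   (s≤s i≤n) = step u e (take w i≤n)

  drop : ∀ {U n a b} (w : Walk U n a b) {i} → i ≤ n → Walk U (n ∸ i) (at w i) b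
  drop w@(here _)     z≤n       = w
  drop w@(step _ _ _) z≤n       = w
  drop (step _ _ w)   (s≤s i≤n) = drop w i≤n

  shortcut : ∀ {U n a b} (w : Walk U n a b) {i j} → i < j → j ≤ n → at w i ≡ at w j →
             ∃[ m ] m < n × Walk U m a b
  shortcut {U} {n} w {i} {j} i<j j≤n eq = i + (n ∸ j) ,
    subst (i + (n ∸ j) <_) (ℕ.m+[n∸m]≡n j≤n) (ℕ.+-monoˡ-< (n ∸ j) i<j) ,
    take w (ℕ.≤-trans (ℕ.<⇒≤ i<j) j≤n) ++ subst (λ x → Walk U (n ∸ j) x _) (sym eq) (drop w j≤n)

  walk-length>0 : ∀ {U n a b} → Walk U n a b → a ≢ b → 0 < n
  walk-length>0 (here _)     a≢b = ⊥-elim (a≢b refl)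
  walk-length>0 (step _ _ _) _   = s≤s z≤n

  -- The stretch of length n of an infinite sequence, beginning at time t.
  along : ∀ {U} (c : ℕ → Fin N) → (∀ t → Adj (c t) (c (suc t))) →
          ∀ n t → (∀ i → i ≤ n → U (c (i + t)) ≡ true) → Walk U n (c t) (c (n + t))
  along c adjacent zero    t u = here (u 0 z≤n)
  along c adjacent (suc n) t u = snoc (along c adjacent n t (λ i i≤n → u i (ℕ.m≤n⇒m≤1+n i≤n))) (adjacent (n + t)) (u (suc n) ℕ.≤-refl)

  -- C is the set of vertices that can be reached from a inside U.
  Component : (Fin N → Bool) → Fin N → (Fin N → Bool) → Set
  Component U a C = ∀ x → (C x ≡ true → ∃[ n ] Walk U n a x) × ((∃[ n ] Walk U n a x) → C x ≡ true)

  component : ∀ U a → ¬ ¬ (∃[ C ] Component U a C)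
  component U a ¬C = ¬¬-decide (λ x → ∃[ n ] Walk U n a x) λ w? →
    ¬C ((λ x → does (w? x)) , λ x → does⇒ (w? x) , dec-true (w? x))

  -- No vertex v of T has two neighbours on the same side in one component of
  -- T - v.
  NoFork : (Fin N → Bool) → Set
  NoFork T = ∀ d {n v a b} → T v ≡ true → a ≢ b → Arc d v a → Arc d v b → ¬ Walk (T ─ v) n a b

  NoFork-mono : ∀ {T T′} → (∀ x → T′ x ≡ true → T x ≡ true) → NoFork T → NoFork T′
  NoFork-mono {T} {T′} T′⊆T nf d v∈ a≢b ea eb w = nf d (T′⊆T _ v∈) a≢b ea eb
    (Walk-mono (λ x x∈ → let (p , q) = ∈─⁻ T′ x∈ in ∈─⁺ T (T′⊆T x p) q) w)

  -- Of three neighbours two are on the same side.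
  no-three : ∀ {T v a b c m n} → NoFork T → T v ≡ true → a ≢ b → a ≢ c → b ≢ c →
             Adj v a → Adj v b → Adj v c → Walk (T ─ v) m a b → Walk (T ─ v) n a c → ⊥
  no-three nf v∈ a≢b a≢c b≢c (true  , ea) (true  , eb) _            w w′ = nf true v∈ a≢b ea eb w
  no-three nf v∈ a≢b a≢c b≢c (false , ea) (false , eb) _            w w′ = nf false v∈ a≢b ea eb w
  no-three nf v∈ a≢b a≢c b≢c (true  , ea) (false , eb) (true  , ec) w w′ = nf true v∈ a≢c ea ec w′
  no-three nf v∈ a≢b a≢c b≢c (true  , ea) (false , eb) (false , ec) w w′ = nf false v∈ b≢c eb ec (reverse w ++ w′)
  no-three nf v∈ a≢b a≢c b≢c (false , ea) (true  , eb) (true  , ec) w w′ = nf true v∈ b≢c eb ec (reverse w ++ w′)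
  no-three nf v∈ a≢b a≢c b≢c (false , ea) (true  , eb) (false , ec) w w′ = nf false v∈ a≢c ea ec w′

  -- The number of arcs inside T.
  E : (Fin N → Bool) → ℕ
  E T = sum (λ u → sum (λ w → ⟦ arc u w ∧ (T u ∧ T w) ⟧))

  -- How often the pair (u , w) occurs in a list.
  occurrences : List (Fin N × Fin N) → Fin N → Fin N → ℕ
  occurrences []             u w = 0
  occurrences ((p , q) ∷ es) u w = δ p u * δ q w + occurrences es u w

  sum-occurrences : ∀ es → sum (λ u → sum (occurrences es u)) ≡ length es
  sum-occurrences [] = sum-zero {N} (λ _ → sum-zero {N} (λ _ → refl))
  sum-occurrences ((p , q) ∷ es) = begin
    sum (λ u → sum (λ w → δ p u * δ q w + occurrences es u w))
      ≡⟨ sum-cong-≗ {N} (λ u → trans (∑-distrib-+ (λ w → δ p u * δ q w) (occurrences es u))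
                      (cong (_+ _) (trans (sum-*ˡ (δ p u) (δ q)) (trans (cong (δ p u *_) (sum-δ q)) (ℕ.*-identityʳ _))))) ⟩
    sum (λ u → δ p u + sum (occurrences es u))
      ≡⟨ ∑-distrib-+ (δ p) _ ⟩
    sum (δ p) + sum (λ u → sum (occurrences es u))
      ≡⟨ cong₂ _+_ (sum-δ p) (sum-occurrences es) ⟩
    suc (length es) ∎
    where open ≡-Reasoning

  occurs : ∀ {es u w} → (u , w) ∈ₗ es → 1 ≤ occurrences es u w
  occurs {_ ∷ es} {u} {w} (here refl) =
    ℕ.≤-trans (ℕ.≤-reflexive (sym (cong₂ _*_ (δ-refl u) (δ-refl w)))) (ℕ.m≤m+n _ (occurrences es u w))
  occurs {(p , q) ∷ es} {u} {w} (there i) = ℕ.≤-trans (occurs i) (ℕ.m≤n+m _ (δ p u * δ q w))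

  -- The arcs in T are at most those inside C, those inside R and those listed.
  E-split : ∀ {T} C R es →
    (∀ {u w} → arc u w ≡ true → T u ≡ true → T w ≡ true →
      (C u ≡ true × C w ≡ true) ⊎ (R u ≡ true × R w ≡ true) ⊎ (u , w) ∈ₗ es) →
    E T ≤ E C + E R + length es
  E-split {T} C R es cover = begin
    E T
      ≤⟨ sum-mono (λ u → sum-mono (pointwise u)) ⟩
    sum (λ u → sum (λ w → e C u w + e R u w + occurrences es u w))
      ≡⟨ sum-cong-≗ {N} (λ u → trans (∑-distrib-+ (λ w → e C u w + e R u w) _) (cong (_+ _) (∑-distrib-+ (e C u) (e R u)))) ⟩
    sum (λ u → sum (e C u) + sum (e R u) + sum (occurrences es u))
      ≡⟨ trans (∑-distrib-+ (λ u → sum (e C u) + sum (e R u)) _) (cong (_+ _) (∑-distrib-+ (λ u → sum (e C u)) _)) ⟩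
    E C + E R + sum (λ u → sum (occurrences es u))
      ≡⟨ cong (E C + E R +_) (sum-occurrences es) ⟩
    E C + E R + length es ∎
    where
    open ℕ.≤-Reasoning
    e : (Fin N → Bool) → Fin N → Fin N → ℕ
    e S u w = ⟦ arc u w ∧ (S u ∧ S w) ⟧

    pointwise : ∀ u w → e T u w ≤ e C u w + e R u w + occurrences es u w
    pointwise u w with arc u w in a | T u in p | T w in q
    ... | false | _     | _     = z≤n
    ... | true  | false | _     = z≤n
    ... | true  | true  | false = z≤n
    ... | true  | true  | true with cover a p q
    ... | inj₁ both rewrite proj₁ both | proj₂ both = s≤s z≤n
    ... | inj₂ (inj₁ both) rewrite proj₁ both | proj₂ both = ℕ.≤-trans (ℕ.m≤n+m 1 ⟦ C u ∧ C w ⟧) (ℕ.m≤m+n _ _)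
    ... | inj₂ (inj₂ i) = ℕ.≤-trans (occurs i) (ℕ.m≤n+m _ _)

  E-empty : ∀ {T} → (∀ x → T x ≡ true → ⊥) → E T ≡ 0
  E-empty {T} empty = sum-zero {N} (λ u → sum-zero {N} (λ w → zeroes u w))
    where
    zeroes : ∀ u w → ⟦ arc u w ∧ (T u ∧ T w) ⟧ ≡ 0
    zeroes u w with arc u w | T u in p
    ... | false | _     = refl
    ... | true  | false = refl
    ... | true  | true  = ⊥-elim (empty u p)

  -- The ordered pair of ends of the arc witnessing Arc d x y.
  arcOf : Bool → Fin N → Fin N → Fin N × Fin N
  arcOf true  x y = x , y
  arcOf false x y = y , x

  module _ (asym : ∀ {u w} → arc u w ≡ true → ¬ arc w u ≡ true) where

    Arc-asym : ∀ d {x y} → Arc d x y → ¬ Arc (not d) x y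
    Arc-asym true  = asym
    Arc-asym false = asym

    Arc-unique : ∀ d d′ {x y} → Arc d x y → Arc d′ x y → arcOf d x y ≡ arcOf d′ x y
    Arc-unique true  true  e f = refl
    Arc-unique false false e f = refl
    Arc-unique true  false e f = ⊥-elim (asym e f)
    Arc-unique false true  e f = ⊥-elim (asym e f)

    irreflexive : ∀ d {x} → ¬ Arc d x x
    irreflexive true  e = asym e e
    irreflexive false e = asym e e

    -- T spans at most 3 (|T| - 1) / 2 arcs.
    Bound : (Fin N → Bool) → Set
    Bound T = 3 + 2 * E T ≤ 3 * card T

    card-step : ∀ {T T′ : Fin N → Bool} {s} → card T ≤ suc s → card T′ < card T → card T′ ≤ s
    card-step p q = ℕ.<⇒≤pred (ℕ.<-≤-trans q p)

    -- The induction step for T, at a vertex v of T.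
    module Step (s : ℕ)
      (IH : ∀ {T v} → card T ≤ s → NoFork T → T v ≡ true → Bound T)
      {T : Fin N → Bool} (|T|≤ : card T ≤ suc s) (nf : NoFork T)
      {v : Fin N} (v∈ : T v ≡ true) where

      ∅ : Fin N → Bool
      ∅ _ = false

      E∅ : E ∅ ≡ 0
      E∅ = E-empty {∅} (λ _ ())

      |T─v|≤ : card (T ─ v) ≤ s
      |T─v|≤ = card-step {T} {T ─ v} |T|≤ (ℕ.≤-reflexive (card-─ T v∈))

      ─⊆ : ∀ x → (T ─ v) x ≡ true → T x ≡ true
      ─⊆ x x∈ = proj₁ (∈─⁻ T x∈)

      -- T - v may be empty, where Bound fails; the weaker 2 E <= 3 card suffices.
      isolated : (∀ a → T a ≡ true → ¬ Adj v a) → ¬ ¬ Bound T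
      isolated none ¬bound = ¬¬-excluded-middle {A = ∃[ u ] (T ─ v) u ≡ true} λ where
          (yes (u , u∈)) → ¬bound (arith-weak {E T} {E (T ─ v)} (card-─ T v∈) E≤
            (ℕ.≤-trans (ℕ.m≤n+m _ 3) (IH |T─v|≤ (NoFork-mono ─⊆ nf) u∈)))
          (no empty) → ¬bound (arith-weak {E T} {E (T ─ v)} (card-─ T v∈) E≤
            (ℕ.≤-trans (ℕ.≤-reflexive (cong (2 *_) (E-empty (λ x x∈ → empty (x , x∈))))) z≤n))
        where
        E≤ : E T ≤ E (T ─ v) + 0 + 0
        E≤ = subst (λ z → E T ≤ E (T ─ v) + z + 0) E∅ (E-split (T ─ v) ∅ [] λ {u} {w} a u∈ w∈ →
          inj₁ ( ∈─⁺ T u∈ (λ { refl → none w w∈ (true , a) })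
               , ∈─⁺ T w∈ (λ { refl → none u u∈ (false , a) })))

      -- A neighbour a of v, and the component C of a in T - v.
      module Neighbour {a : Fin N} {d : Bool} (a∈ : T a ≡ true) (e : Arc d v a)
                       {C : Fin N → Bool} (isC : Component (T ─ v) a C) where

        a≢v : a ≢ v
        a≢v refl = irreflexive d e

        C⊆ : ∀ x → C x ≡ true → (T ─ v) x ≡ true
        C⊆ x x∈ = end∈ (proj₂ (proj₁ (isC x) x∈))

        a∈T─v : (T ─ v) a ≡ true
        a∈T─v = ∈─⁺ T a∈ a≢v

        -- If a vertex t of T - v lies outside C, then T is the union of C ∪ v (here
        -- C′) and T ∖ C, which share just v and have no arcs across.
        cut : ∀ {t} → (T ─ v) t ≡ true → C t ≡ false → Bound T
        cut {t} t∈ t∉C = arith-cut {E T} {E C′} {E R} {t₁ = card C′} sizes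
          (E-split C′ R [] cover)
          (IH |C′|≤ (NoFork-mono C′⊆ nf) v∈C′)
          (IH |R|≤ (NoFork-mono R⊆ nf) v∈R)
          where
          X C′ R : Fin N → Bool
          X  = (T ─ v) ∖ C
          C′ = T ∖ X
          R  = T ∖ C

          C⊆T : ∀ x → C x ≡ true → T x ≡ true
          C⊆T x x∈ = ─⊆ x (C⊆ x x∈)

          X⊆T : ∀ x → X x ≡ true → T x ≡ true
          X⊆T x x∈ = ─⊆ x (proj₁ (∈∖⁻ (T ─ v) C x∈))

          R⊆ : ∀ x → R x ≡ true → T x ≡ true
          R⊆ x x∈ = proj₁ (∈∖⁻ T C x∈)

          C′⊆ : ∀ x → C′ x ≡ true → T x ≡ true
          C′⊆ x x∈ = proj₁ (∈∖⁻ T X x∈)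

          C+R : card C + card R ≡ card T
          C+R = card-∖ T C⊆T

          X+C′ : card X + card C′ ≡ card T
          X+C′ = card-∖ T X⊆T

          C+X : suc (card C + card X) ≡ card T
          C+X = trans (cong suc (card-∖ (T ─ v) C⊆)) (card-─ T v∈)

          sizes : card C′ + card R ≡ suc (card T)
          sizes = ℕ.+-cancelˡ-≡ (card C + card X) _ _ (begin
            card C + card X + (card C′ + card R)     ≡⟨ lemma (card C) (card X) (card C′) (card R) ⟩
            (card X + card C′) + (card C + card R)   ≡⟨ cong₂ _+_ (trans X+C′ (sym C+X)) C+R ⟩
            suc (card C + card X) + card T           ≡⟨ ℕ.+-suc (card C + card X) (card T) ⟨
            card C + card X + suc (card T)           ∎)
            where
            open ≡-Reasoning
            lemma : ∀ c x c′ r → c + x + (c′ + r) ≡ (x + c′) + (c + r)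
            lemma = solve-∀

          |C′|≤ : card C′ ≤ s
          |C′|≤ = card-step {T} {C′} |T|≤ (subst (card C′ <_) X+C′
            (ℕ.+-monoˡ-≤ (card C′) (card-pos X (∈∖⁺ (T ─ v) C t∈ t∉C))))

          |R|≤ : card R ≤ s
          |R|≤ = card-step {T} {R} |T|≤ (subst (card R <_) C+R
            (ℕ.+-monoˡ-≤ (card R) (card-pos C (proj₂ (isC a) (0 , here a∈T─v)))))

          v∉C : C v ≡ false
          v∉C = Bool.¬-not (λ v∈C → proj₂ (∈─⁻ T (C⊆ v v∈C)) refl)

          v∈R : R v ≡ true
          v∈R = ∈∖⁺ T C v∈ v∉C

          v∈C′ : C′ v ≡ true
          v∈C′ = ∈∖⁺ T X v∈ (Bool.¬-not (λ v∈X → proj₂ (∈─⁻ T (proj₁ (∈∖⁻ (T ─ v) C v∈X))) refl))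

          both-R : ∀ {x y} → Adj x y → X x ≡ true → T y ≡ true → R x ≡ true × R y ≡ true
          both-R {x} {y} f x∈X y∈ = let (x∈ , x∉C) = ∈∖⁻ (T ─ v) C x∈X in
            ∈∖⁺ T C (X⊆T x x∈X) x∉C , ∈∖⁺ T C y∈ (Bool.¬-not λ y∈C →
              let (n , w) = proj₁ (isC y) y∈C in
              case trans (sym x∉C) (proj₂ (isC x) (suc n , snoc w (Adj-sym f) x∈)) of λ ())

          cover : ∀ {u w} → arc u w ≡ true → T u ≡ true → T w ≡ true →
                  (C′ u ≡ true × C′ w ≡ true) ⊎ (R u ≡ true × R w ≡ true) ⊎ (u , w) ∈ₗ []
          cover {u} {w} f u∈ w∈ with true-or-false (X u) | true-or-false (X w)
          ... | inj₁ p | _      = inj₂ (inj₁ (both-R (true , f) p w∈))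
          ... | inj₂ p | inj₁ q = inj₂ (inj₁ (swap (both-R (false , f) q u∈)))
          ... | inj₂ p | inj₂ q = inj₁ (∈∖⁺ T X u∈ p , ∈∖⁺ T X w∈ q)

        -- The case that v has no neighbour besides a.
        leaf : (∀ b → T b ≡ true → Adj v b → b ≡ a) → Bound T
        leaf only = arith-leaf {E T} {E (T ─ v)} (card-─ T v∈) E≤ (IH |T─v|≤ (NoFork-mono ─⊆ nf) a∈T─v)
          where
          es : List (Fin N × Fin N)
          es = arcOf d v a ∷ []

          at-v : ∀ d′ {y} → T y ≡ true → Arc d′ v y → arcOf d′ v y ∈ₗ es
          at-v d′ {y} y∈ f with only y y∈ (d′ , f)
          ... | refl = here (Arc-unique d′ d f e)

          cover : ∀ {u w} → arc u w ≡ true → T u ≡ true → T w ≡ true →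
                  ((T ─ v) u ≡ true × (T ─ v) w ≡ true) ⊎ (∅ u ≡ true × ∅ w ≡ true) ⊎ (u , w) ∈ₗ es
          cover {u} {w} f u∈ w∈ with u Fin.≟ v | w Fin.≟ v
          ... | yes refl | _        = inj₂ (inj₂ (at-v true w∈ f))
          ... | no  _    | yes refl = inj₂ (inj₂ (at-v false u∈ f))
          ... | no  u≢v  | no  w≢v  rewrite u∈ | w∈ = inj₁ (refl , refl)

          E≤ : E T ≤ E (T ─ v) + 0 + 1
          E≤ = subst (λ z → E T ≤ E (T ─ v) + z + 1) E∅ (E-split (T ─ v) ∅ es cover)

        -- The case that T - v is connected and v has a second neighbour b. The walk
        -- from a to b in T - v begins with the edge a a′ and does not return to a. With
        -- R′ the component of a′ in T - v - a, and R the rest of T - v, the only arcs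
        -- of T outside R and R′ are those joining v to a, v to b, and a to a′.
        module Cycle (all-C : ∀ t → (T ─ v) t ≡ true → C t ≡ true)
                     {b : Fin N} {d′ : Bool} (b∈ : T b ≡ true) (e′ : Arc d′ v b) (b≢a : b ≢ a)
                     {a′ : Fin N} {dₐ : Bool} (eₐ : Arc dₐ a a′)
                     {m : ℕ} (wₐ : Walk (T ─ v ─ a) m a′ b)
                     {R′ : Fin N → Bool} (isR′ : Component (T ─ v ─ a) a′ R′) where

          es : List (Fin N × Fin N)
          es = arcOf d v a ∷ arcOf d′ v b ∷ arcOf dₐ a a′ ∷ []

          R : Fin N → Bool
          R = (T ─ v) ∖ R′

          R′⊆ : ∀ x → R′ x ≡ true → (T ─ v ─ a) x ≡ true
          R′⊆ x x∈ = end∈ (proj₂ (proj₁ (isR′ x) x∈))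

          R′⊆T─v : ∀ x → R′ x ≡ true → (T ─ v) x ≡ true
          R′⊆T─v x x∈ = proj₁ (∈─⁻ (T ─ v) (R′⊆ x x∈))

          at-v : ∀ dᵥ {y} → T y ≡ true → Arc dᵥ v y → arcOf dᵥ v y ∈ₗ es
          at-v dᵥ {y} y∈ f with y Fin.≟ a | y Fin.≟ b
          ... | yes refl | _        = here (Arc-unique dᵥ d f e)
          ... | no  _    | yes refl = there (here (Arc-unique dᵥ d′ f e′))
          ... | no  y≢a  | no  y≢b  = ⊥-elim (no-three nf v∈ (λ q → b≢a (sym q)) (λ q → y≢a (sym q)) (λ q → y≢b (sym q))
              (d , e) (d′ , e′) (dᵥ , f) (proj₂ (reach b∈ (d′ , e′))) (proj₂ (reach y∈ (dᵥ , f))))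
            where
            reach : ∀ {z} → T z ≡ true → Adj v z → ∃[ n ] Walk (T ─ v) n a z
            reach {z} z∈ (d″ , g) = proj₁ (isC z) (all-C z (∈─⁺ T z∈ (λ { refl → irreflexive d″ g })))

          -- A vertex x of R adjacent to R′ can only be a, as otherwise x would belong to
          -- the component R′; and then y = a′, since a′, y and v are joined in T - a.
          bridge : ∀ dᵥ {x y} → R′ y ≡ true → R x ≡ true → Arc dᵥ x y → arcOf dᵥ x y ∈ₗ es
          bridge dᵥ {x} {y} y∈R′ x∈R f with x Fin.≟ a | y Fin.≟ a′
          ... | no x≢a | _ = ⊥-elim (case trans (sym (proj₂ x∈)) (proj₂ (isR′ x)
                (_ , snoc (proj₂ (proj₁ (isR′ y) y∈R′)) (not dᵥ , Arc-flip dᵥ f) (∈─⁺ (T ─ v) (proj₁ x∈) x≢a))) of λ ())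
            where
            x∈ = ∈∖⁻ (T ─ v) R′ x∈R
          ... | yes refl | yes refl = there (there (here (Arc-unique dᵥ dₐ f eₐ)))
          ... | yes refl | no y≢a′ = ⊥-elim (no-three nf a∈ (λ q → y≢a′ (sym q)) a′≢v y≢v
                (dₐ , eₐ) (dᵥ , f) (not d , Arc-flip d e)
                (inT─a (proj₂ (proj₁ (isR′ y) y∈R′)))
                (snoc (inT─a wₐ) (not d′ , Arc-flip d′ e′) (∈─⁺ T v∈ (λ q → a≢v (sym q)))))
            where
            inT─a : ∀ {n p q} → Walk (T ─ v ─ a) n p q → Walk (T ─ a) n p q
            inT─a = Walk-mono (λ z z∈ → let (p , q) = ∈─⁻ (T ─ v) z∈ in ∈─⁺ T (─⊆ z p) q)
            y≢v : y ≢ v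
            y≢v = proj₂ (∈─⁻ T (R′⊆T─v y y∈R′))
            a′≢v : a′ ≢ v
            a′≢v = proj₂ (∈─⁻ T (proj₁ (∈─⁻ (T ─ v) (start∈ wₐ))))

          ∈R : ∀ {x} → T x ≡ true → x ≢ v → R′ x ≡ false → R x ≡ true
          ∈R x∈ x≢v x∉R′ = ∈∖⁺ (T ─ v) R′ (∈─⁺ T x∈ x≢v) x∉R′

          cover : ∀ {u w} → arc u w ≡ true → T u ≡ true → T w ≡ true →
                  (R′ u ≡ true × R′ w ≡ true) ⊎ (R u ≡ true × R w ≡ true) ⊎ (u , w) ∈ₗ es
          cover {u} {w} f u∈ w∈ = go (u Fin.≟ v) (w Fin.≟ v)
            where
            go : Dec (u ≡ v) → Dec (w ≡ v) →
                 (R′ u ≡ true × R′ w ≡ true) ⊎ (R u ≡ true × R w ≡ true) ⊎ (u , w) ∈ₗ es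
            go (yes refl) _          = inj₂ (inj₂ (at-v true w∈ f))
            go (no  _)    (yes refl) = inj₂ (inj₂ (at-v false u∈ f))
            go (no  u≢v)  (no  w≢v)  with true-or-false (R′ u) | true-or-false (R′ w)
            ... | inj₁ p | inj₁ q = inj₁ (p , q)
            ... | inj₁ p | inj₂ q = inj₂ (inj₂ (bridge false p (∈R w∈ w≢v q) f))
            ... | inj₂ p | inj₁ q = inj₂ (inj₂ (bridge true q (∈R u∈ u≢v p) f))
            ... | inj₂ p | inj₂ q = inj₂ (inj₁ (∈R u∈ u≢v p , ∈R w∈ w≢v q))

          R′+R : card R′ + card R ≡ card (T ─ v)
          R′+R = card-∖ (T ─ v) R′⊆T─v

          bound : Bound T
          bound = arith-cycle {E T} {E R′} {E R} {t₁ = card R′}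
            (trans (cong suc R′+R) (card-─ T v∈))
            (E-split R′ R es cover)
            (IH (ℕ.≤-trans (ℕ.m≤m+n (card R′) (card R)) R′+R≤) (NoFork-mono (λ x x∈ → ─⊆ x (R′⊆T─v x x∈)) nf)
                (proj₂ (isR′ a′) (0 , here (start∈ wₐ))))
            (IH (ℕ.≤-trans (ℕ.m≤n+m (card R) (card R′)) R′+R≤) (NoFork-mono (λ x x∈ → ─⊆ x (proj₁ (∈∖⁻ (T ─ v) R′ x∈))) nf)
                (∈∖⁺ (T ─ v) R′ a∈T─v (Bool.¬-not λ a∈R′ → proj₂ (∈─⁻ (T ─ v) (R′⊆ a a∈R′)) refl)))
            where
            R′+R≤ : card R′ + card R ≤ s
            R′+R≤ = subst (_≤ s) (sym R′+R) |T─v|≤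

        bound : ¬ ¬ Bound T
        bound ¬bound = ¬¬-excluded-middle {A = ∃[ t ] (T ─ v) t ≡ true × C t ≡ false} λ where
          (yes (t , t∈ , t∉C)) → ¬bound (cut {t} t∈ t∉C)
          (no  none) → ¬¬-excluded-middle {A = ∃[ b ] T b ≡ true × Adj v b × b ≢ a} λ where
            (no ¬b) → ¬bound (leaf λ b b∈ f → decidable-stable (b Fin.≟ a) λ b≢a → ¬b (b , b∈ , f , b≢a))
            (yes (b , b∈ , (d′ , e′) , b≢a)) →
              let all-C = λ t t∈ → decidable-stable (C t Bool.≟ true) (λ t∉ → none (t , t∈ , Bool.¬-not t∉))
                  (n , w) = proj₁ (isC b) (all-C b (∈─⁺ T b∈ (λ { refl → irreflexive d′ e′ })))
                  (a′ , (dₐ , eₐ) , m , wₐ) = final-exit (λ q → b≢a (sym q)) w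
              in component (T ─ v ─ a) a′ λ (R′ , isR′) →
                   ¬bound (Cycle.bound all-C {d′ = d′} b∈ e′ b≢a {dₐ = dₐ} eₐ wₐ isR′)

      stepBound : Bound T
      stepBound = decidable-stable (_ ℕ.≤? _) λ ¬bound → ¬¬-excluded-middle {A = ∃[ a ] T a ≡ true × Adj v a} λ where
        (no none) → isolated (λ a a∈ e → none (a , a∈ , e)) ¬bound
        (yes (a , a∈ , d , e)) → component (T ─ v) a λ (C , isC) →
          Neighbour.bound {d = d} a∈ e isC ¬bound

    -- The argument s bounds the size of T and drives the induction.
    fork-free-bound : ∀ s {T v} → card T ≤ s → NoFork T → T v ≡ true → 3 + 2 * E T ≤ 3 * card T
    fork-free-bound zero    {T} |T|≤ nf v∈ = ⊥-elim (ℕ.<⇒≱ (card-pos T v∈) |T|≤)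
    fork-free-bound (suc s) {T} |T|≤ nf v∈ = Step.stepBound s (λ {T} → fork-free-bound s {T}) {T} |T|≤ nf v∈

-- Cycles of relations and of induced subdigraphs

module _ {A : Set} where
  -- No directed cycle along R, in the form used for digraphs but for an arbitrary
  -- relation.
  Acyclicᴿ : (A → A → Set) → Set
  Acyclicᴿ R = ∀ v vs → ¬ (Unique (v ∷ vs) × Linked R (v ∷ vs ∷ʳ v))

  successor : ∀ {R : A → A → Set} {x} xs {z} → Linked R (xs ∷ʳ z) → x ∈ₗ xs → ∃[ y ] R x y
  successor (_ ∷ [])     (r ∷ _)  (here refl) = _ , r
  successor (_ ∷ _ ∷ _)  (r ∷ _)  (here refl) = _ , r
  successor (_ ∷ xs@(_ ∷ _)) (_ ∷ rs) (there i) = successor xs rs i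

  predecessor : ∀ {R : A → A → Set} {x y} ys → Linked R (y ∷ ys) → x ∈ₗ ys → ∃[ z ] R z x
  predecessor (_ ∷ _)  (r ∷ _)  (here refl) = _ , r
  predecessor (_ ∷ ys) (_ ∷ rs) (there i)   = predecessor ys rs i

  ∈-rotate : ∀ {x v : A} vs → x ∈ₗ (v ∷ vs) → x ∈ₗ (vs ∷ʳ v)
  ∈-rotate []       (here p)          = here p
  ∈-rotate (_ ∷ vs) (here p)          = there (∈-rotate vs (here p))
  ∈-rotate (_ ∷ vs) (there (here p))  = here p
  ∈-rotate (_ ∷ vs) (there (there i)) = there (∈-rotate vs (there i))

  -- Adding a point h without successors or without predecessors makes no cycle.
  acyclic-extend : ∀ {R R′ : A → A → Set} (_≟_ : (x y : A) → Dec (x ≡ y)) (h : A) →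
    (∀ {x y} → R′ x y → x ≢ h → y ≢ h → R x y) →
    (∀ y → ¬ R′ h y) ⊎ (∀ y → ¬ R′ y h) →
    Acyclicᴿ R → Acyclicᴿ R′
  acyclic-extend {R} {R′} _≟_ h R′⇒R stuck acyclic v vs (unique , linked)
    with Any.any? (h ≟_) (v ∷ vs)
  ... | yes h∈ = case stuck of λ where
    (inj₁ none) → let (y , r) = successor (v ∷ vs) linked h∈ in none y r
    (inj₂ none) → let (y , r) = predecessor (vs ∷ʳ v) linked (∈-rotate vs h∈) in none y r
  ... | no h∉ = acyclic v vs (unique , restrict linked (All.∷ʳ⁺ avoids (All.head avoids)))
    where
    avoids : All (_≢ h) (v ∷ vs)
    avoids = All.map (λ h≢x x≡h → h≢x (sym x≡h)) (All.¬Any⇒All¬ (v ∷ vs) h∉)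
    restrict : ∀ {xs} → Linked R′ xs → All (_≢ h) xs → Linked R xs
    restrict []       _             = []
    restrict [-]      _             = [-]
    restrict (r ∷ rs) (p ∷ q ∷ ps) = R′⇒R r p q ∷ restrict rs (q ∷ ps)

  acyclic-⊆ : ∀ {R R′ : A → A → Set} → (∀ {x y} → R′ x y → R x y) → Acyclicᴿ R → Acyclicᴿ R′
  acyclic-⊆ R′⇒R acyclic v vs (unique , linked) = acyclic v vs (unique , Linked.map R′⇒R linked)

∈-subset⁺ : ∀ {N ℓ} {P : Fin N → Set ℓ} (P? : Decidable P) {i} → P i → i ∈ subset P?
∈-subset⁺ P? {i} p = Vec.lookup⇒[]= i _ (trans (Vec.lookup∘tabulate (λ j → does (P? j)) i) (dec-true (P? i) p))

module _ {N} {D : Digraph N} {S : Subset N} where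
  private
    module D = Digraph D
    module D[S] = Digraph (induced D S)

    -- The decidable predicate by which induced selects its arcs.
    Inside : Fin (N ℕ.* N) → Set
    Inside e = e ∈ D.A × proj₁ (remQuot {N} N e) ∈ S × proj₂ (remQuot {N} N e) ∈ S

    inside? : Decidable Inside
    inside? e = (e Subset.∈? D.A) ×-dec ((proj₁ (remQuot {N} N e) Subset.∈? S) ×-dec (proj₂ (remQuot {N} N e) Subset.∈? S))

  induced⁺ : ∀ {x y} → x D.⟶ y → x ∈ S → y ∈ S → x D[S].⟶ y
  induced⁺ {x} {y} a x∈ y∈ = ∈-subset⁺ inside?
    (a , subst (λ p → proj₁ p ∈ S) (sym (Fin.remQuot-combine x y)) x∈
       , subst (λ p → proj₂ p ∈ S) (sym (Fin.remQuot-combine x y)) y∈)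

  induced⁻ : ∀ {x y} → x D[S].⟶ y → x D.⟶ y × x ∈ S × y ∈ S
  induced⁻ {x} {y} e = let (a , x∈ , y∈) = ∈-subset⁻ inside? e in
    a , subst (λ p → proj₁ p ∈ S) (Fin.remQuot-combine x y) x∈
      , subst (λ p → proj₂ p ∈ S) (Fin.remQuot-combine x y) y∈

  induced-subdigraph : induced D S IsSubdigraphOf D
  induced-subdigraph = (λ x∈ → proj₁ (Subset.x∈p∩q⁻ _ _ x∈)) , λ e∈ → proj₁ (∈-subset⁻ inside? e∈)

-- Dicritical oriented graphs: colourings with a hole

-- K stands for k - 1.
module Critical {N K : ℕ} (D : Digraph N) (oriented : Oriented D) (critical : Dicritical (suc K) D) where
  open import Data.Nat using (_+_; _*_; _≤_; _<_)
  open Digraph D using (V; A; _⟶_; ends)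

  arc : Fin N → Fin N → Bool
  arc x y = lookup A (combine x y)

  open Graph arc public

  arc⇒⟶ : ∀ {x y} → arc x y ≡ true → x ⟶ y
  arc⇒⟶ {x} {y} = Vec.lookup⇒[]= (combine x y) A

  asym : ∀ {x y} → arc x y ≡ true → ¬ arc y x ≡ true
  asym {x} {y} a b = oriented (arc⇒⟶ {x} {y} a) (arc⇒⟶ b)

  no-loop : ∀ d {x} → ¬ Arc d x x
  no-loop = irreflexive asym

  Arc-ends : ∀ d {x y} → Arc d x y → x ∈ V × y ∈ V
  Arc-ends true  {x} {y} a = ends (arc⇒⟶ {x} {y} a)
  Arc-ends false {x} {y} a = let (y∈ , x∈) = ends (arc⇒⟶ {y} {x} a) in x∈ , y∈

  Colour : ℕ → Set
  Colour i = 1 ≤ i × i ≤ K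

  -- The arcs of D - h both of whose ends have colour i.
  Mono : Fin N → (Fin N → ℕ) → ℕ → Fin N → Fin N → Set
  Mono h φ i x y = arc x y ≡ true × (x ≢ h × φ x ≡ i) × (y ≢ h × φ y ≡ i)

  -- φ is a K-dicolouring of D - h; its value at h is irrelevant.
  record Valid (h : Fin N) (φ : Fin N → ℕ) : Set where
    field
      range   : ∀ {x} → x ∈ V → x ≢ h → Colour (φ x)
      acyclic : ∀ i → Acyclicᴿ (Mono h φ i)

  recolour : Fin N → ℕ → (Fin N → ℕ) → Fin N → ℕ
  recolour h i φ x with x Fin.≟ h
  ... | yes _ = i
  ... | no  _ = φ x

  recolour-≡ : ∀ h {i} φ → recolour h i φ h ≡ i
  recolour-≡ h φ with h Fin.≟ h
  ... | yes _  = refl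
  ... | no h≢h = ⊥-elim (h≢h refl)

  recolour-≢ : ∀ {h x} i φ → x ≢ h → recolour h i φ x ≡ φ x
  recolour-≢ {h} {x} i φ x≢h with x Fin.≟ h
  ... | yes x≡h = ⊥-elim (x≢h x≡h)
  ... | no _    = refl

  ∈colourClass⁺ : ∀ (φ : Fin N → ℕ) {i x} → φ x ≡ i → x ∈ colourClass φ i
  ∈colourClass⁺ φ {i} = ∈-subset⁺ (λ v → φ v ℕ.≟ i)

  ∈colourClass⁻ : ∀ (φ : Fin N → ℕ) {i x} → x ∈ colourClass φ i → φ x ≡ i
  ∈colourClass⁻ φ {i} = ∈-subset⁻ (λ v → φ v ℕ.≟ i)

  valid-exists : ∀ {h} → h ∈ V → ∃[ φ ] Valid h φ
  valid-exists {h} h∈V = colouring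
   where
    others? : Decidable (_≢ h)
    others? x = ¬? (x Fin.≟ h)

    D─h : Digraph N
    D─h = induced D (subset others?)

    V≢ : Digraph.V D─h ≢ V
    V≢ eq = ∈-subset⁻ others? (proj₂ (Subset.x∈p∩q⁻ V (subset others?) (subst (h ∈_) (sym eq) h∈V))) refl

    colouring : ∃[ φ ] Valid h φ
    colouring with proj₂ critical D─h (induced-subdigraph {D = D} , inj₁ V≢)
    ... | j , ((φ , dicolouring) , _) , s≤s j≤K = φ , record
      { range   = λ x∈ x≢h → let (p , q) = range (Subset.x∈p∩q⁺ (x∈ , ∈-subset⁺ others? x≢h)) in p , ℕ.≤-trans q j≤K
      ; acyclic = λ i → acyclic-⊆ (λ {x} {y} (a , (x≢h , φx) , (y≢h , φy)) →
          induced⁺ {D = D─h} {colourClass φ i} {x} {y} (induced⁺ {D = D} {subset others?} {x} {y} (arc⇒⟶ a) (∈-subset⁺ others? x≢h) (∈-subset⁺ others? y≢h))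
            (∈colourClass⁺ φ φx) (∈colourClass⁺ φ φy)) (acyclic i) }
      where open IsDicolouring dicolouring

  not-dicolourable : ¬ Dicolourable D K
  not-dicolourable c = ℕ.<⇒≱ ℕ.≤-refl (proj₂ (proj₁ critical) K c)

  Arc? : ∀ d x y → Dec (Arc d x y)
  Arc? d x y = arcs d x y Bool.≟ true

  -- Otherwise h could be given the missing colour i: in the new colour class h
  -- would have no successor (or no predecessor), and D would be K-dicolourable.
  all-colours : ∀ d {h φ i} → Valid h φ → Colour i → ∃[ y ] Arc d h y × φ y ≡ i
  all-colours d {h} {φ} {i} valid i∈ with Fin.any? (λ y → Arc? d h y ×-dec (φ y ℕ.≟ i))
  ... | yes found = found
  ... | no  none  = ⊥-elim (not-dicolourable (ψ , record { range = range′ ; acyclic = acyclic′ }))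
    where
    open Valid valid
    ψ : Fin N → ℕ
    ψ = recolour h i φ

    ψ-off : ∀ {x} → x ≢ h → ψ x ≡ φ x
    ψ-off = recolour-≢ i φ

    range′ : ∀ {x} → x ∈ V → Colour (ψ x)
    range′ {x} x∈ with x Fin.≟ h
    ... | yes _   = i∈
    ... | no  x≢h = range x∈ x≢h

    MonoD : ℕ → Fin N → Fin N → Set
    MonoD j x y = arc x y ≡ true × ψ x ≡ j × ψ y ≡ j

    at-h : ∀ {j} d → (∀ y → Arc d h y → φ y ≢ i) → ∀ y → Arc d h y → ¬ (ψ h ≡ j × ψ y ≡ j)
    at-h d none y e (ψh , ψy) = none y e (trans (sym (ψ-off y≢h)) (trans ψy (trans (sym ψh) (recolour-≡ h φ))))
      where
      y≢h : y ≢ h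
      y≢h refl = no-loop d e

    stuck : ∀ d j → (∀ y → Arc d h y → φ y ≢ i) → (∀ y → ¬ MonoD j h y) ⊎ (∀ y → ¬ MonoD j y h)
    stuck true  j none = inj₁ λ y (a , p , q) → at-h true none y a (p , q)
    stuck false j none = inj₂ λ y (a , p , q) → at-h false none y a (q , p)

    acyclic′ : ∀ j → Acyclic (induced D (colourClass ψ j))
    acyclic′ j = acyclic-⊆
      (λ {x} {y} a → let (a , x∈ , y∈) = induced⁻ {D = D} {colourClass ψ j} {x} {y} a in Vec.[]=⇒lookup a , ∈colourClass⁻ ψ x∈ , ∈colourClass⁻ ψ y∈)
      (acyclic-extend Fin._≟_ h
        (λ (a , p , q) x≢h y≢h → a , (x≢h , trans (sym (ψ-off x≢h)) p) , (y≢h , trans (sym (ψ-off y≢h)) q))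
        (stuck d j (λ y e p → none (y , e , p))) (acyclic j))

  -- Out-degree (for true) and in-degree (for false).
  deg : Bool → Fin N → ℕ
  deg d x = card (arcs d x)

  -- For each colour a neighbour of the hole on the side d with that colour. The
  -- colours are 1, ..., K, indexed by Fin K with a shift of one. A neighbour that
  -- represents no colour makes the degree exceed K.
  module Representatives (d : Bool) {h : Fin N} {φ : Fin N → ℕ} (valid : Valid h φ) where
    represent : (i : Fin K) → ∃[ y ] Arc d h y × φ y ≡ suc (toℕ i)
    represent i = all-colours d valid (s≤s z≤n , Fin.toℕ<n i)

    rep : Fin K → Fin N
    rep i = proj₁ (represent i)

    φ-rep : ∀ i → φ (rep i) ≡ suc (toℕ i)
    φ-rep i = proj₂ (proj₂ (represent i))

    rep-injective : ∀ i j → rep i ≡ rep j → i ≡ j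
    rep-injective i j eq = Fin.toℕ-injective (ℕ.suc-injective (trans (sym (φ-rep i)) (trans (cong φ eq) (φ-rep j))))

    K≤deg : K ≤ deg d h
    K≤deg = injection⇒≤card (arcs d h) rep (λ i → proj₁ (proj₂ (represent i))) rep-injective

    extra : ∀ z → Arc d h z → (∀ i → rep i ≢ z) → K < deg d h
    extra z e rep≢z = injection⇒≤card (arcs d h) rep⁺ rep⁺-arc rep⁺-injective
      where
      rep⁺ : Fin (suc K) → Fin N
      rep⁺ zero    = z
      rep⁺ (suc i) = rep i

      rep⁺-arc : ∀ i → Arc d h (rep⁺ i)
      rep⁺-arc zero    = e
      rep⁺-arc (suc i) = proj₁ (proj₂ (represent i))

      rep⁺-injective : ∀ i j → rep⁺ i ≡ rep⁺ j → i ≡ j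
      rep⁺-injective zero    zero    _  = refl
      rep⁺-injective zero    (suc j) eq = ⊥-elim (rep≢z j (sym eq))
      rep⁺-injective (suc i) zero    eq = ⊥-elim (rep≢z i eq)
      rep⁺-injective (suc i) (suc j) eq = cong suc (rep-injective i j eq)

    clash : ∀ {x y} → Arc d h x → Arc d h y → x ≢ y → φ x ≡ φ y → K < deg d h
    clash {x} {y} ex ey x≢y φx≡φy with Fin.any? (λ i → rep i Fin.≟ x)
    ... | no  missed         = extra x ex (λ i eq → missed (i , eq))
    ... | yes (i , rep-i≡x) = extra y ey λ j rep-j≡y →
      let i≡j = Fin.toℕ-injective (ℕ.suc-injective (begin
                  suc (toℕ i) ≡⟨ φ-rep i ⟨
                  φ (rep i)   ≡⟨ cong φ rep-i≡x ⟩
                  φ x         ≡⟨ φx≡φy ⟩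
                  φ y         ≡⟨ cong φ rep-j≡y ⟨
                  φ (rep j)   ≡⟨ φ-rep j ⟩
                  suc (toℕ j) ∎))
      in x≢y (trans (sym rep-i≡x) (trans (cong rep i≡j) rep-j≡y))
      where open ≡-Reasoning

  K≤degree : ∀ d {h} → h ∈ V → K ≤ deg d h
  K≤degree d h∈V = Representatives.K≤deg d (proj₂ (valid-exists h∈V))

  -- Vertices whose in-degree and out-degree have the least possible value.
  Low : Fin N → Set
  Low x = x ∈ V × deg true x ≡ K × deg false x ≡ K

  Low? : Decidable Low
  Low? x = (x Subset.∈? V) ×-dec ((deg true x ℕ.≟ K) ×-dec (deg false x ℕ.≟ K))

  Low-degree : ∀ d {x} → Low x → deg d x ≡ K
  Low-degree true  (_ , p , _) = p
  Low-degree false (_ , _ , p) = p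

  distinct-colours : ∀ d {h φ x y} → Low h → Valid h φ → Arc d h x → Arc d h y → φ x ≡ φ y → x ≡ y
  distinct-colours d {x = x} {y} low valid ex ey φx≡φy with x Fin.≟ y
  ... | yes x≡y = x≡y
  ... | no  x≢y = ⊥-elim (ℕ.<⇒≢ (Representatives.clash d valid ex ey x≢y φx≡φy) (sym (Low-degree d low)))

  -- Moving the hole from h to u. On the side of h where u lies, u was the only
  -- neighbour with the colour that h receives, so h is on no monochromatic cycle
  -- of D - u.
  move : ∀ {h u φ} → Low h → Adj h u → Valid h φ → Valid u (recolour h (φ u) φ)
  move {h} {u} {φ} low (d , e) valid = record { range = range′ ; acyclic = acyclic′ }
    where
    open Valid valid
    ψ : Fin N → ℕ
    ψ = recolour h (φ u) φ

    ψ-off : ∀ {x} → x ≢ h → ψ x ≡ φ x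
    ψ-off = recolour-≢ (φ u) φ

    u≢h : u ≢ h
    u≢h refl = no-loop d e

    range′ : ∀ {x} → x ∈ V → x ≢ u → Colour (ψ x)
    range′ {x} x∈ x≢u with x Fin.≟ h
    ... | yes _   = range (proj₂ (Arc-ends d e)) u≢h
    ... | no  x≢h = range x∈ x≢h

    at-h : ∀ {j} d → Arc d h u → ∀ y → Arc d h y → y ≢ u → ¬ (ψ h ≡ j × ψ y ≡ j)
    at-h d e y f y≢u (ψh , ψy) = y≢u (distinct-colours d low valid f e
      (trans (sym (ψ-off y≢h)) (trans ψy (trans (sym ψh) (recolour-≡ h φ)))))
      where
      y≢h : y ≢ h
      y≢h refl = no-loop d f

    stuck : ∀ d j → Arc d h u → (∀ y → ¬ Mono u ψ j h y) ⊎ (∀ y → ¬ Mono u ψ j y h)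
    stuck true  j e = inj₁ λ y (f , (_ , p) , (y≢u , q)) → at-h true e y f y≢u (p , q)
    stuck false j e = inj₂ λ y (f , (y≢u , q) , (_ , p)) → at-h false e y f y≢u (p , q)

    acyclic′ : ∀ j → Acyclicᴿ (Mono u ψ j)
    acyclic′ j = acyclic-extend Fin._≟_ h
      (λ (f , (_ , p) , (_ , q)) x≢h y≢h → f , (x≢h , trans (sym (ψ-off x≢h)) p) , (y≢h , trans (sym (ψ-off y≢h)) q))
      (stuck d j e) (acyclic j)

  -- Pushing the hole around a cycle

  -- A cycle of length L = M + 1 through low vertices, as a sequence of period L.
  -- The last hypothesis excludes a chord at c t on the same side as the vertex
  -- c (M + t) behind c t. The hole starts at c 0.
  module Rotation
    (c : ℕ → Fin N) (M : ℕ) (1<M : 1 < M)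
    (period   : ∀ t → c (suc M + t) ≡ c t)
    (apart    : ∀ t j → j < M → c (suc j + t) ≢ c t)
    (adjacent : ∀ t → Adj (c t) (c (suc t)))
    (low      : ∀ t → Low (c t))
    (no-chord : ∀ t d j → 1 < j → j < M → Arc d (c t) (c (j + t)) → ¬ Arc d (c t) (c (M + t)))
    {φ₀ : Fin N → ℕ} (valid₀ : Valid (c 0) φ₀) where

    L : ℕ
    L = suc M

    -- The colouring at time t, when the hole is at c t.
    φ : ℕ → Fin N → ℕ
    φ zero    = φ₀
    φ (suc t) = recolour (c t) (φ t (c (suc t))) (φ t)

    valid : ∀ t → Valid (c t) (φ t)
    valid zero    = valid₀
    valid (suc t) = move (low t) (adjacent t) (valid t)

    -- The colour of the vertex ahead of the hole, to be passed on to the vertex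
    -- that the hole leaves.
    x : ℕ → ℕ
    x t = φ t (c (suc t))

    φ-behind : ∀ t → φ (suc t) (c t) ≡ x t
    φ-behind t = recolour-≡ (c t) (φ t)

    φ-stays : ∀ n t {w} → (∀ i → i < n → w ≢ c (i + t)) → φ (n + t) w ≡ φ t w
    φ-stays zero    t _     = refl
    φ-stays (suc n) t avoid = trans (recolour-≢ _ (φ (n + t)) (avoid n ℕ.≤-refl))
                                    (φ-stays n t (λ i i<n → avoid i (ℕ.m<n⇒m<1+n i<n)))

    c-behind : ∀ t → c (M + suc t) ≡ c t
    c-behind t = trans (cong c (ℕ.+-suc M t)) (period t)

    -- The colour left behind at c t is the one met when the hole comes back to the
    -- vertex before c t; only M = L - 1 vertices of the cycle are coloured.
    x-period : ∀ t → x (M + t) ≡ x t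
    x-period t = begin
      φ (M + t) (c (suc M + t))              ≡⟨ cong (φ (M + t)) (period t) ⟩
      φ (M + t) (c t)                        ≡⟨ cong (λ s → φ s (c t)) M+t ⟩
      φ (ℕ.pred M + suc t) (c t)             ≡⟨ φ-stays (ℕ.pred M) (suc t) avoid ⟩
      φ (suc t) (c t)                        ≡⟨ φ-behind t ⟩
      x t                                    ∎
      where
      open ≡-Reasoning
      M≡ : suc (ℕ.pred M) ≡ M
      M≡ = ℕ.suc-pred M {{ℕ.>-nonZero (ℕ.<-trans (s≤s z≤n) 1<M)}}
      M+t : M + t ≡ ℕ.pred M + suc t
      M+t = trans (cong (_+ t) (sym M≡)) (sym (ℕ.+-suc (ℕ.pred M) t))
      avoid : ∀ i → i < ℕ.pred M → c t ≢ c (i + suc t)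
      avoid i i<M-1 eq = apart t i (subst (i <_) M≡ (ℕ.m<n⇒m<1+n i<M-1))
                           (trans (cong c (sym (ℕ.+-suc i t))) (sym eq))

    x-turn : ∀ t → x (L + t) ≡ x (suc t)
    x-turn t = trans (cong x (sym (ℕ.+-suc M t))) (x-period (suc t))

    c-turn : ∀ t → c (suc (L + t)) ≡ c (suc t)
    c-turn t = trans (cong c (sym (ℕ.+-suc L t))) (period (suc t))

    -- The colours ahead of and behind the hole after one more full turn.
    φ-turn-ahead : ∀ s → φ (L + s) (c (suc s)) ≡ x (suc s)
    φ-turn-ahead s = trans (cong (φ (L + s)) (sym (c-turn s))) (x-turn s)

    φ-turn-behind : ∀ t → φ (L + suc t) (c t) ≡ x (suc t)
    φ-turn-behind t = begin
      φ (L + suc t) (c t)         ≡⟨ cong (λ s → φ s (c t)) (ℕ.+-suc L t) ⟩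
      φ (suc (L + t)) (c t)       ≡⟨ cong (φ (suc (L + t))) (period t) ⟨
      φ (suc (L + t)) (c (L + t)) ≡⟨ φ-behind (L + t) ⟩
      x (L + t)                   ≡⟨ x-turn t ⟩
      x (suc t)                   ∎
      where open ≡-Reasoning

    -- The hole is at h = c (suc t), and the vertex behind it, of colour x t, is on
    -- the side p. After a full turn the colour x t occurs again on the side p, at
    -- some w. If w were off the cycle, it would have had that colour before the
    -- turn as well, twice on the same side.
    turn : ∀ t p → Arc p (c (suc t)) (c t) →
           (Arc p (c (suc t)) (c (suc (suc t))) × x (suc (suc t)) ≡ x t) ⊎ x (suc t) ≡ x t
    turn t p behind = locate w e φw (ℕ.anyUpTo? (λ j → w Fin.≟ c (j + s)) L)
      where
      s : ℕ
      s = suc t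

      h : Fin N
      h = c s

      colour : Colour (x t)
      colour = subst Colour (φ-behind t) (Valid.range (valid s) (proj₁ (low t)) (λ eq → apart t 0 (ℕ.<-trans (s≤s z≤n) 1<M) (sym eq)))

      found : ∃[ w ] Arc p h w × φ (L + s) w ≡ x t
      found = all-colours p (subst (λ v → Valid v (φ (L + s))) (period s) (valid (L + s))) colour

      w : Fin N
      w = proj₁ found
      e : Arc p h w
      e = proj₁ (proj₂ found)
      φw : φ (L + s) w ≡ x t
      φw = proj₂ (proj₂ found)

      locate : ∀ w → Arc p h w → φ (L + s) w ≡ x t → Dec (∃[ j ] j < L × w ≡ c (j + s)) →
               (Arc p h (c (suc s)) × x (suc s) ≡ x t) ⊎ x s ≡ x t
      locate w e φw (no off) = ⊥-elim (off (M , ℕ.≤-refl , trans w≡ (sym (c-behind t))))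
        where
        w≡ : w ≡ c t
        w≡ = distinct-colours p (low s) (valid s) e behind (begin
          φ s w         ≡⟨ φ-stays L s (λ i i<L eq → off (i , i<L , eq)) ⟨
          φ (L + s) w   ≡⟨ φw ⟩
          x t           ≡⟨ φ-behind t ⟨
          φ s (c t)     ∎)
          where open ≡-Reasoning
      locate w e φw (yes (zero , _ , refl))      = ⊥-elim (no-loop p e)
      locate w e φw (yes (suc zero , _ , refl))  = inj₁ (e , trans (sym (φ-turn-ahead s)) φw)
      locate w e φw (yes (j@(suc (suc _)) , s≤s j≤M , refl)) with ℕ.m≤n⇒m<n∨m≡n j≤M
      ... | inj₁ j<M  = ⊥-elim (no-chord s p j (s≤s (s≤s z≤n)) j<M e (subst (Arc p h) (sym (c-behind t)) behind))
      ... | inj₂ refl = inj₂ (trans (sym (φ-turn-behind t)) (trans (cong (φ (L + s)) (sym (c-behind t))) φw))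

    -- Both cycle-neighbours of c (suc t₀) are on the side q: the contradiction.
    module Fork (t₀ : ℕ) (q : Bool)
      (behind : Arc q (c (suc t₀)) (c t₀)) (ahead : Arc q (c (suc t₀)) (c (suc (suc t₀)))) where

      α β : ℕ
      α = x (suc t₀)
      β = x t₀

      α≢β : α ≢ β
      α≢β eq = apart t₀ 1 1<M (distinct-colours q (low (suc t₀)) (valid (suc t₀)) ahead behind (trans eq (sym (φ-behind t₀))))

      -- The side r of the vertex behind the hole at time suc t determines the colours
      -- behind and ahead.
      Alternates : ℕ → Bool → Set
      Alternates t r = (r ≡ q × x (suc t) ≡ α × x t ≡ β) ⊎ (r ≡ not q × x (suc t) ≡ β × x t ≡ α)

      alternate : ∀ i → ∃[ r ] Arc r (c (suc (i + t₀))) (c (i + t₀)) × Alternates (i + t₀) r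
      alternate zero = q , behind , inj₁ (refl , refl , refl)
      alternate (suc i) with alternate i
      ... | r , e , colours with turn (i + t₀) r e
      ... | inj₂ same = ⊥-elim (case colours of λ where
              (inj₁ (_ , p , p′)) → α≢β (trans (sym p) (trans same p′))
              (inj₂ (_ , p , p′)) → α≢β (sym (trans (sym p) (trans same p′))))
      ... | inj₁ (f , back) = not r , Arc-flip r f , (case colours of λ where
              (inj₁ (refl , p , p′)) → inj₂ (refl , trans back p′ , p)
              (inj₂ (refl , p , p′)) → inj₁ (Bool.not-involutive q , trans back p′ , p))

      -- After L steps the side is q again, but x (L + t₀) is x (suc t₀) = α and not β.
      impossible : ⊥
      impossible with alternate L
      ... | _ , _ , inj₁ (_ , _ , p)    = α≢β (trans (sym (x-turn t₀)) p)
      ... | _ , e , inj₂ (refl , _ , _) = Arc-asym asym q behind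
                                            (subst₂ (Arc (not q)) (c-turn t₀) (period t₀) e)

  low : Fin N → Bool
  low v = does (Low? v)

  low⁻ : ∀ {v} → low v ≡ true → Low v
  low⁻ {v} = does⇒ (Low? v)

  low⁺ : ∀ {v} → Low v → low v ≡ true
  low⁺ {v} = dec-true (Low? v)

  -- No low vertex has two neighbours on the same side that are joined by a walk of
  -- length n through other low vertices.
  ForkFree : ℕ → Set
  ForkFree n = ∀ q {v a b} → Low v → a ≢ b → Arc q v a → Arc q v b → ¬ Walk (low ─ v) n a b

  -- A shortest counterexample. Together with v the walk is a cycle f of length
  -- L = d + 2, and c is its periodic continuation.
  module Minimal {d : ℕ} (shorter : ∀ {n} → n < d → ForkFree n)
    (q : Bool) {v a b : Fin N} (low-v : Low v) (a≢b : a ≢ b) (ea : Arc q v a) (eb : Arc q v b)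
    (w : Walk (low ─ v) d a b) where

    M L : ℕ
    M = suc d
    L = suc M

    f : ℕ → Fin N
    f zero    = v
    f (suc i) = at w i

    c : ℕ → Fin N
    c t = f (t % L)

    f-low : ∀ i → Low (f i)
    f-low zero    = low-v
    f-low (suc i) = low⁻ (proj₁ (∈─⁻ low {v} {at w i} (at∈ w i)))

    v≢at : ∀ i → at w i ≢ v
    v≢at i = proj₂ (∈─⁻ low (at∈ w i))

    f-adjacent : ∀ i → i < M → Adj (f i) (f (suc i))
    f-adjacent zero    _         = q , subst (Arc q v) (sym (at-start w)) ea
    f-adjacent (suc i) (s≤s i<d) = at-adjacent w i<d

    -- A repeated vertex would allow a shorter walk.
    f-increasing : ∀ {i j} → i < j → j < L → f i ≢ f j
    f-increasing {zero}  {suc j} _         _         eq = v≢at j (sym eq)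
    f-increasing {suc i} {suc j} (s≤s i<j) (s≤s (s≤s j≤d)) eq =
      let (m , m<d , w′) = shortcut w i<j j≤d eq in shorter m<d q low-v a≢b ea eb w′

    f-injective : ∀ {i j} → i < L → j < L → f i ≡ f j → i ≡ j
    f-injective {i} {j} i<L j<L eq with ℕ.<-cmp i j
    ... | tri< i<j _ _ = ⊥-elim (f-increasing i<j j<L eq)
    ... | tri≈ _ i≡j _ = i≡j
    ... | tri> _ _ j<i = ⊥-elim (f-increasing j<i i<L (sym eq))

    period : ∀ t → c (L + t) ≡ c t
    period t = cong f (trans (cong (_% L) (ℕ.+-comm L t)) (ℕ.[m+n]%n≡m%n t L))

    apart : ∀ t j → j < M → c (suc j + t) ≢ c t
    apart t j j<M eq = %-moves (suc j) t L (s≤s z≤n) (s≤s j<M)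
      (f-injective (ℕ.m%n<n (suc j + t) L) (ℕ.m%n<n t L) eq)

    adjacent : ∀ t → Adj (c t) (c (suc t))
    adjacent t with ℕ.m≤n⇒m<n∨m≡n (ℕ.m%n<n t L)
    ... | inj₁ inside = subst (λ r → Adj (c t) (f r)) (sym (trans (%-shift 1 t L) (ℕ.m<n⇒m%n≡m inside)))
                          (f-adjacent (t % L) (ℕ.s≤s⁻¹ inside))
    ... | inj₂ wrap = subst₂ (λ r r′ → Adj (f r) (f r′)) (sym (ℕ.suc-injective wrap))
                        (sym (trans (%-shift 1 t L) (trans (cong (_% L) wrap) (ℕ.n%n≡0 L))))
                        (Adj-sym (q , subst (Arc q v) (sym (at-end w)) eb))

    -- The stretch of the cycle from c (j + t) to c (M + t) would be a shorter walk
    -- between two neighbours of c t on the side p.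
    no-chord : ∀ t p j → 1 < j → j < M → Arc p (c t) (c (j + t)) → ¬ Arc p (c t) (c (M + t))
    no-chord t p j@(suc j′) 1<j j<M e e′ =
      shorter (ℕ.≤-trans (ℕ.∸-monoʳ-< {M} 1<j (ℕ.<⇒≤ j<M)) (ℕ.≤-reflexive (ℕ.m+n∸m≡n 1 d))) p (f-low (t % L)) ends-apart e e′
        (subst (Walk _ (M ∸ j) (c (j + t))) (cong c end)
          (along c adjacent (M ∸ j) (j + t) avoid))
      where
      end : (M ∸ j) + (j + t) ≡ M + t
      end = trans (sym (ℕ.+-assoc (M ∸ j) j t)) (cong (_+ t) (ℕ.m∸n+n≡m (ℕ.<⇒≤ j<M)))

      ends-apart : c (j + t) ≢ c (M + t)
      ends-apart eq with ℕ.m<n⇒0<n∸m j<M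
      ... | 0<M-j = %-moves (M ∸ j) (j + t) L 0<M-j (s≤s (ℕ.m∸n≤m M j)) (trans (cong (_% L) end)
          (f-injective (ℕ.m%n<n (M + t) L) (ℕ.m%n<n (j + t) L) (sym eq)))

      avoid : ∀ i → i ≤ M ∸ j → (low ─ c t) (c (i + (j + t))) ≡ true
      avoid i i≤ = ∈─⁺ low (low⁺ (f-low ((i + (j + t)) % L))) λ eq → apart t (i + j′)
        (ℕ.≤-trans (ℕ.≤-reflexive (sym (ℕ.+-suc i j′))) (ℕ.≤-trans (ℕ.+-monoˡ-≤ j i≤) (ℕ.≤-reflexive (ℕ.m∸n+n≡m (ℕ.<⇒≤ j<M)))))
        (trans (cong c (trans (cong (_+ t) (sym (ℕ.+-suc i j′))) (ℕ.+-assoc i j t))) eq)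

    1<M : 1 < M
    1<M = s≤s (walk-length>0 w a≢b)

    -- The hole comes back to v at time L = suc M, which makes the vertex b behind v
    -- available as c M.
    impossible : ⊥
    impossible = Rotation.Fork.impossible c M 1<M period apart adjacent (λ t → f-low (t % L)) no-chord
      (proj₂ (valid-exists (proj₁ low-v)))
      M q (subst₂ (Arc q) (sym c-L) (sym c-M) eb)
          (subst₂ (Arc q) (sym c-L) (sym c-1) ea)
      where
      c-L : c L ≡ v
      c-L = cong f (ℕ.n%n≡0 L)
      c-M : c M ≡ b
      c-M = trans (cong f (ℕ.m<n⇒m%n≡m {n = L} {m = M} ℕ.≤-refl)) (at-end w)
      c-1 : c (suc L) ≡ a
      c-1 = trans (cong f (trans (%-shift 1 L L) (cong (λ r → (1 + r) % L) (ℕ.n%n≡0 L)))) (at-start w)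

  -- Strong induction on the length, which s bounds.
  fork-free : ∀ s {n} → n < s → ForkFree n
  fork-free (suc s) {n} (s≤s n≤s) q low-v a≢b ea eb w =
    Minimal.impossible (λ m<n → fork-free s (ℕ.<-≤-trans m<n n≤s)) q low-v a≢b ea eb w

  low-NoFork : NoFork low
  low-NoFork d v∈ a≢b ea eb w = fork-free _ ℕ.≤-refl d (low⁻ v∈) a≢b ea eb w

  -- Counting arcs

  arcs-total : ∀ d → sum (deg d) ≡ m D
  arcs-total true  = sym (trans (∣∣≡card A) (sum-combine {N} (λ e → ⟦ lookup A e ⟧)))
  arcs-total false = trans (∑-comm (λ x y → ⟦ arc y x ⟧)) (arcs-total true)

  degree-sum : sum (λ x → deg true x + deg false x) ≡ 2 * m D
  degree-sum = begin
    sum (λ x → deg true x + deg false x) ≡⟨ ∑-distrib-+ (deg true) (deg false) ⟩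
    sum (deg true) + sum (deg false)     ≡⟨ cong₂ _+_ (arcs-total true) (arcs-total false) ⟩
    m D + m D                            ≡⟨ cong (_+_ (m D)) (ℕ.+-identityʳ (m D)) ⟨
    2 * m D                              ∎
    where open ≡-Reasoning

  degree-bound : (1 + 2 * K) * n D ≤ 2 * m D + card low
  degree-bound = begin
    (1 + 2 * K) * n D                                        ≡⟨ cong ((1 + 2 * K) *_) (∣∣≡card V) ⟩
    (1 + 2 * K) * card (lookup V)                            ≡⟨ sum-*ˡ (1 + 2 * K) (λ x → ⟦ lookup V x ⟧) ⟨
    sum (λ x → (1 + 2 * K) * ⟦ lookup V x ⟧)                 ≤⟨ sum-mono at-vertex ⟩
    sum (λ x → deg true x + deg false x + ⟦ low x ⟧)         ≡⟨ ∑-distrib-+ (λ x → deg true x + deg false x) _ ⟩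
    sum (λ x → deg true x + deg false x) + card low          ≡⟨ cong (_+ card low) degree-sum ⟩
    2 * m D + card low                                       ∎
    where
    open ℕ.≤-Reasoning

    double : ∀ K → 1 + 2 * K ≡ K + K + 1
    double = solve-∀

    large : ∀ {p q} → K ≤ p → K ≤ q → ¬ (p ≡ K × q ≡ K) → 1 + 2 * K ≤ p + q
    large {p} {q} K≤p K≤q not-both with ℕ.m≤n⇒m<n∨m≡n K≤p | ℕ.m≤n⇒m<n∨m≡n K≤q
    ... | inj₁ K<p | _        = ℕ.≤-trans (ℕ.≤-reflexive (cong (λ z → suc (K + z)) (ℕ.+-identityʳ K))) (ℕ.+-mono-≤ K<p K≤q)
    ... | inj₂ _   | inj₁ K<q = ℕ.≤-trans (ℕ.≤-reflexive (trans (cong (λ z → suc (K + z)) (ℕ.+-identityʳ K)) (sym (ℕ.+-suc K K)))) (ℕ.+-mono-≤ K≤p K<q)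
    ... | inj₂ p   | inj₂ q   = ⊥-elim (not-both (sym p , sym q))

    at-V : ∀ x → x ∈ V → (d : Dec (Low x)) → 1 + 2 * K ≤ deg true x + deg false x + ⟦ does d ⟧
    at-V x x∈ (yes (_ , p , q)) rewrite p | q = ℕ.≤-reflexive (double K)
    at-V x x∈ (no ¬low) = ℕ.≤-trans (large (K≤degree true x∈) (K≤degree false x∈) (λ (p , q) → ¬low (x∈ , p , q))) (ℕ.m≤m+n _ 0)

    at-vertex : ∀ x → (1 + 2 * K) * ⟦ lookup V x ⟧ ≤ deg true x + deg false x + ⟦ low x ⟧
    at-vertex x with lookup V x in eq
    ... | false = ℕ.≤-trans (ℕ.≤-reflexive (ℕ.*-zeroʳ (1 + 2 * K))) z≤n
    ... | true  = ℕ.≤-trans (ℕ.≤-reflexive (ℕ.*-identityʳ (1 + 2 * K))) (at-V x (Vec.lookup⇒[]= x V eq) (Low? x))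

  low-degree-bound : 2 * K * card low ≤ m D + E low
  low-degree-bound = begin
    2 * K * card low
      ≡⟨ sum-*ˡ (2 * K) (λ x → ⟦ low x ⟧) ⟨
    sum (λ x → 2 * K * ⟦ low x ⟧)
      ≡⟨ sum-cong-≗ {N} (λ x → at-low x (Low? x)) ⟩
    sum (λ x → ⟦ low x ⟧ * deg true x + ⟦ low x ⟧ * deg false x)
      ≡⟨ trans (∑-distrib-+ (λ x → ⟦ low x ⟧ * deg true x) _) (cong₂ _+_ (expand true) (trans (expand false) (∑-comm (λ x y → ⟦ low x ⟧ * ⟦ arc y x ⟧)))) ⟩
    sum (λ x → sum (λ y → ⟦ low x ⟧ * ⟦ arc x y ⟧)) + sum (λ x → sum (λ y → ⟦ low y ⟧ * ⟦ arc x y ⟧))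
      ≡⟨ ∑∑-distrib (λ x y → ⟦ low x ⟧ * ⟦ arc x y ⟧) (λ x y → ⟦ low y ⟧ * ⟦ arc x y ⟧) ⟨
    sum (λ x → sum (λ y → ⟦ low x ⟧ * ⟦ arc x y ⟧ + ⟦ low y ⟧ * ⟦ arc x y ⟧))
      ≤⟨ sum-mono (λ x → sum-mono (λ y → at-arc (arc x y) (low x) (low y))) ⟩
    sum (λ x → sum (λ y → ⟦ arc x y ⟧ + ⟦ arc x y ∧ (low x ∧ low y) ⟧))
      ≡⟨ ∑∑-distrib (λ x y → ⟦ arc x y ⟧) (λ x y → ⟦ arc x y ∧ (low x ∧ low y) ⟧) ⟩
    sum (deg true) + E low
      ≡⟨ cong (_+ E low) (arcs-total true) ⟩
    m D + E low ∎
    where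
    open ℕ.≤-Reasoning

    ∑∑-distrib : ∀ (f g : Fin N → Fin N → ℕ) →
      sum (λ x → sum (λ y → f x y + g x y)) ≡ sum (λ x → sum (f x)) + sum (λ x → sum (g x))
    ∑∑-distrib f g = trans (sum-cong-≗ {N} (λ x → ∑-distrib-+ (f x) (g x))) (∑-distrib-+ (λ x → sum (f x)) _)

    expand : ∀ d → sum (λ x → ⟦ low x ⟧ * deg d x) ≡ sum (λ x → sum (λ y → ⟦ low x ⟧ * ⟦ arcs d x y ⟧))
    expand d = sum-cong-≗ {N} (λ x → sym (sum-*ˡ ⟦ low x ⟧ (λ y → ⟦ arcs d x y ⟧)))

    at-low : ∀ x (d : Dec (Low x)) → 2 * K * ⟦ does d ⟧ ≡ ⟦ does d ⟧ * deg true x + ⟦ does d ⟧ * deg false x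
    at-low x (yes (_ , p , q)) rewrite p | q = ones K
      where
      ones : ∀ K → 2 * K * 1 ≡ 1 * K + 1 * K
      ones = solve-∀
    at-low x (no _) = ℕ.*-zeroʳ (2 * K)

    -- An arc is counted once for each low end.
    at-arc : ∀ a p q → ⟦ p ⟧ * ⟦ a ⟧ + ⟦ q ⟧ * ⟦ a ⟧ ≤ ⟦ a ⟧ + ⟦ a ∧ (p ∧ q) ⟧
    at-arc true  true  true  = ℕ.≤-refl
    at-arc true  true  false = ℕ.≤-refl
    at-arc true  false true  = ℕ.≤-refl
    at-arc true  false false = z≤n
    at-arc false true  true  = ℕ.≤-refl
    at-arc false true  false = ℕ.≤-refl
    at-arc false false true  = ℕ.≤-refl
    at-arc false false false = ℕ.≤-refl

  -- The empty digraph has a colouring with no colours at all.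
  nonempty : 0 < n D
  nonempty with Fin.any? (λ x → x Subset.∈? V)
  ... | yes (x , x∈) = subst (0 <_) (sym (∣∣≡card V)) (card-pos (lookup V) (Vec.[]=⇒lookup x∈))
  ... | no  empty    = ⊥-elim (not-dicolourable ((λ _ → 0) , record
    { range   = λ {x} x∈ → ⊥-elim (empty (x , x∈))
    ; acyclic = λ i → λ
      { v []      (_ , e ∷ _) → ⊥-elim (empty (v , proj₁ (in-V {i} e)))
      ; v (_ ∷ _) (_ , e ∷ _) → ⊥-elim (empty (v , proj₁ (in-V {i} e))) } }))
    where
    in-V : ∀ {i x y} → Digraph._⟶_ (induced D (colourClass (λ _ → 0) i)) x y → x ∈ V × y ∈ V
    in-V {i} {x} {y} e = ends (proj₁ (induced⁻ {D = D} {colourClass (λ _ → 0) i} {x} {y} e))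

  low-forest : ∀ {v} → low v ≡ true → 3 + 2 * E low ≤ 3 * card low
  low-forest {v} v∈ = fork-free-bound asym (card low) {low} {v} ℕ.≤-refl low-NoFork v∈

module NaturalBound where
  open import Data.Nat using (_+_; _*_; _≤_; _<_)

  -- The inequality multiplied by 4 (2k - 3), for k = 3 + j.
  natural-bound : ∀ j {N} (D : Digraph N) → Oriented D → Dicritical (3 + j) D →
    (5 + 4 * j) * (5 + 2 * j) * n D + 3 ≤ (12 + 8 * j) * m D
  natural-bound j D oriented critical =
    combine-bounds j {n D} {m D} {card low} {E low} nonempty (subst (λ k → k * n D ≤ 2 * m D + card low) (odd j) degree-bound)
      (subst (λ k → k * card low ≤ m D + E low) (even j) low-degree-bound) forest
    where
    open Critical D oriented critical
    odd : ∀ j → 1 + 2 * (2 + j) ≡ 5 + 2 * j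
    odd = solve-∀
    even : ∀ j → 2 * (2 + j) ≡ 4 + 2 * j
    even = solve-∀
    forest : card low ≡ 0 ⊎ 3 + 2 * E low ≤ 3 * card low
    forest with Fin.any? (λ v → low v Bool.≟ true)
    ... | yes (v , v∈) = inj₂ (low-forest {v} v∈)
    ... | no  none     = inj₁ (sum-zero (λ v → cong ⟦_⟧ (Bool.¬-not (λ v∈ → none (v , v∈)))))

open NaturalBound

-- The rational form of the bound

open import Data.Integer as ℤ using (+_)
import Data.Integer.Properties as ℤ
open import Data.Rational using (ℚ; _/_; _+_; _-_; _*_; _≤_; _≥_; toℚᵘ)
import Data.Rational.Properties as ℚ
open import Data.Rational.Solver using (module +-*-Solver)
open import Data.Rational.Unnormalised as ℚᵘ using (mkℚᵘ; *≡*)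
import Data.Rational.Unnormalised.Properties as ℚᵘ

toℚᵘ-fromℕ : ∀ a → toℚᵘ (fromℕ a) ℚᵘ.≃ mkℚᵘ (+ a) 0
toℚᵘ-fromℕ a = ℚ.toℚᵘ-fromℚᵘ (mkℚᵘ (+ a) 0)

fromℕ-+ : ∀ a b → fromℕ (a ℕ.+ b) ≡ fromℕ a + fromℕ b
fromℕ-+ a b = ℚ.toℚᵘ-injective (begin
  toℚᵘ (fromℕ (a ℕ.+ b))                 ≈⟨ toℚᵘ-fromℕ (a ℕ.+ b) ⟩
  mkℚᵘ (+ (a ℕ.+ b)) 0                   ≈⟨ *≡* (cong (ℤ._* + 1) (sym (cong₂ ℤ._+_ (ℤ.*-identityʳ (+ a)) (ℤ.*-identityʳ (+ b))))) ⟩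
  mkℚᵘ (+ a) 0 ℚᵘ.+ mkℚᵘ (+ b) 0         ≈⟨ ℚᵘ.+-cong (toℚᵘ-fromℕ a) (toℚᵘ-fromℕ b) ⟨
  toℚᵘ (fromℕ a) ℚᵘ.+ toℚᵘ (fromℕ b)     ≈⟨ ℚ.toℚᵘ-homo-+ (fromℕ a) (fromℕ b) ⟨
  toℚᵘ (fromℕ a + fromℕ b)               ∎)
  where open import Relation.Binary.Reasoning.Setoid ℚᵘ.≃-setoid

fromℕ-* : ∀ a b → fromℕ (a ℕ.* b) ≡ fromℕ a * fromℕ b
fromℕ-* a b = ℚ.toℚᵘ-injective (begin
  toℚᵘ (fromℕ (a ℕ.* b))                 ≈⟨ toℚᵘ-fromℕ (a ℕ.* b) ⟩
  mkℚᵘ (+ (a ℕ.* b)) 0                   ≈⟨ *≡* (cong (ℤ._* + 1) (ℤ.pos-* a b)) ⟩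
  mkℚᵘ (+ a) 0 ℚᵘ.* mkℚᵘ (+ b) 0         ≈⟨ ℚᵘ.*-cong (toℚᵘ-fromℕ a) (toℚᵘ-fromℕ b) ⟨
  toℚᵘ (fromℕ a) ℚᵘ.* toℚᵘ (fromℕ b)     ≈⟨ ℚ.toℚᵘ-homo-* (fromℕ a) (fromℕ b) ⟨
  toℚᵘ (fromℕ a * fromℕ b)               ∎)
  where open import Relation.Binary.Reasoning.Setoid ℚᵘ.≃-setoid

fromℕ-mono-≤ : ∀ {a b} → a ℕ.≤ b → fromℕ a ≤ fromℕ b
fromℕ-mono-≤ {a} {b} a≤b = ℚ.toℚᵘ-cancel-≤ (begin
  toℚᵘ (fromℕ a) ≃⟨ toℚᵘ-fromℕ a ⟩
  mkℚᵘ (+ a) 0   ≤⟨ ℚᵘ.*≤* (ℤ.*-monoʳ-≤-nonNeg (+ 1) (ℤ.+≤+ a≤b)) ⟩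
  mkℚᵘ (+ b) 0   ≃⟨ toℚᵘ-fromℕ b ⟨
  toℚᵘ (fromℕ b) ∎)
  where open ℚᵘ.≤-Reasoning

/-cancel : ∀ a n .{{_ : NonZero n}} → (+ a) / n * fromℕ n ≡ fromℕ a
/-cancel a n@(suc n-1) = ℚ.toℚᵘ-injective (begin
  toℚᵘ ((+ a) / n * fromℕ n)             ≈⟨ ℚ.toℚᵘ-homo-* ((+ a) / n) (fromℕ n) ⟩
  toℚᵘ ((+ a) / n) ℚᵘ.* toℚᵘ (fromℕ n)   ≈⟨ ℚᵘ.*-cong (ℚ.toℚᵘ-fromℚᵘ (mkℚᵘ (+ a) n-1)) (toℚᵘ-fromℕ n) ⟩
  mkℚᵘ (+ a) n-1 ℚᵘ.* mkℚᵘ (+ n) 0       ≈⟨ *≡* (trans (ℤ.*-identityʳ (+ a ℤ.* + n)) (cong (λ z → + a ℤ.* + z) (sym (ℕ.*-identityʳ n)))) ⟩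
  mkℚᵘ (+ a) 0                           ≈⟨ toℚᵘ-fromℕ a ⟨
  toℚᵘ (fromℕ a)                         ∎)
  where open import Relation.Binary.Reasoning.Setoid ℚᵘ.≃-setoid

-- The denominators p = 4k - 6 and r = 4 (2k - 3) are parameters, as they do not
-- reduce to the closed forms on the right of the two equations.
rational-bound : ∀ j n m p r .{{_ : NonZero p}} .{{_ : NonZero r}} →
  p ≡ 6 ℕ.+ 4 ℕ.* j → r ≡ 12 ℕ.+ 8 ℕ.* j →
  (5 ℕ.+ 4 ℕ.* j) ℕ.* (5 ℕ.+ 2 ℕ.* j) ℕ.* n ℕ.+ 3 ℕ.≤ (12 ℕ.+ 8 ℕ.* j) ℕ.* m →
  fromℕ m ≥ (fromℕ (3 ℕ.+ j) - (+ 3) / 4 - (+ 1) / p) * fromℕ n + (+ 3) / r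
rational-bound j n m p r@(suc r-1) refl eq bound = ℚ.*-cancelʳ-≤-pos (fromℕ r) {{ℚ.normalize-pos r 1}} (begin
  ((fromℕ (3 ℕ.+ j) - (+ 3) / 4 - z) * fromℕ n + y) * fromℕ r
    ≡⟨ cong₂ (λ a b → ((a - (+ 3) / 4 - z) * fromℕ n + y) * b) (fromℕ-+ 3 j) r≡ ⟩
  ((fromℕ 3 + t - (+ 3) / 4 - z) * fromℕ n + y) * (fromℕ 12 + fromℕ 8 * t)
    ≡⟨ expand t (fromℕ n) z y ⟩
  (fromℕ 27 + fromℕ 30 * t + fromℕ 8 * t * t - fromℕ 2 * (z * (fromℕ 6 + fromℕ 4 * t))) * fromℕ n + y * (fromℕ 12 + fromℕ 8 * t)
    ≡⟨ cong₂ (λ a b → (fromℕ 27 + fromℕ 30 * t + fromℕ 8 * t * t - fromℕ 2 * a) * fromℕ n + b) zp≡ yr≡ ⟩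
  (fromℕ 27 + fromℕ 30 * t + fromℕ 8 * t * t - fromℕ 2 * fromℕ 1) * fromℕ n + fromℕ 3
    ≡⟨ factor t (fromℕ n) ⟩
  (fromℕ 5 + fromℕ 4 * t) * (fromℕ 5 + fromℕ 2 * t) * fromℕ n + fromℕ 3
    ≡⟨ lhs≡ ⟨
  fromℕ ((5 ℕ.+ 4 ℕ.* j) ℕ.* (5 ℕ.+ 2 ℕ.* j) ℕ.* n ℕ.+ 3)
    ≤⟨ fromℕ-mono-≤ bound ⟩
  fromℕ ((12 ℕ.+ 8 ℕ.* j) ℕ.* m)
    ≡⟨ cong fromℕ (trans (cong (ℕ._* m) (sym eq)) (ℕ.*-comm r m)) ⟩
  fromℕ (m ℕ.* r)
    ≡⟨ fromℕ-* m r ⟩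
  fromℕ m * fromℕ r ∎)
  where
  open ℚ.≤-Reasoning
  t z y : ℚ
  t = fromℕ j
  z = (+ 1) / p
  y = (+ 3) / r

  affine : ∀ a b → fromℕ (a ℕ.+ b ℕ.* j) ≡ fromℕ a + fromℕ b * t
  affine a b = trans (fromℕ-+ a (b ℕ.* j)) (cong (λ q → fromℕ a + q) (fromℕ-* b j))

  r≡ : fromℕ r ≡ fromℕ 12 + fromℕ 8 * t
  r≡ = trans (cong fromℕ eq) (affine 12 8)

  zp≡ : z * (fromℕ 6 + fromℕ 4 * t) ≡ fromℕ 1
  zp≡ = trans (cong (z *_) (sym (affine 6 4))) (/-cancel 1 p)

  yr≡ : y * (fromℕ 12 + fromℕ 8 * t) ≡ fromℕ 3
  yr≡ = trans (cong (y *_) (sym r≡)) (/-cancel 3 r)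

  lhs≡ : fromℕ ((5 ℕ.+ 4 ℕ.* j) ℕ.* (5 ℕ.+ 2 ℕ.* j) ℕ.* n ℕ.+ 3) ≡
         (fromℕ 5 + fromℕ 4 * t) * (fromℕ 5 + fromℕ 2 * t) * fromℕ n + fromℕ 3
  lhs≡ = trans (fromℕ-+ ((5 ℕ.+ 4 ℕ.* j) ℕ.* (5 ℕ.+ 2 ℕ.* j) ℕ.* n) 3) (cong (_+ fromℕ 3)
           (trans (fromℕ-* ((5 ℕ.+ 4 ℕ.* j) ℕ.* (5 ℕ.+ 2 ℕ.* j)) n) (cong (_* fromℕ n)
             (trans (fromℕ-* (5 ℕ.+ 4 ℕ.* j) (5 ℕ.+ 2 ℕ.* j)) (cong₂ _*_ (affine 5 4) (affine 5 2))))))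

  -- The product z (6 + 4 t) is kept together, since it equals 1.
  expand : ∀ t n z y →
    ((fromℕ 3 + t - (+ 3) / 4 - z) * n + y) * (fromℕ 12 + fromℕ 8 * t) ≡
    (fromℕ 27 + fromℕ 30 * t + fromℕ 8 * t * t - fromℕ 2 * (z * (fromℕ 6 + fromℕ 4 * t))) * n + y * (fromℕ 12 + fromℕ 8 * t)
  expand = solve 4 (λ t n z y →
    ((con (fromℕ 3) :+ t :- con ((+ 3) / 4) :- z) :* n :+ y) :* (con (fromℕ 12) :+ con (fromℕ 8) :* t) :=
    (con (fromℕ 27) :+ con (fromℕ 30) :* t :+ con (fromℕ 8) :* t :* t :- con (fromℕ 2) :* (z :* (con (fromℕ 6) :+ con (fromℕ 4) :* t))) :* n
      :+ y :* (con (fromℕ 12) :+ con (fromℕ 8) :* t)) refl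
    where open +-*-Solver

  factor : ∀ t n →
    (fromℕ 27 + fromℕ 30 * t + fromℕ 8 * t * t - fromℕ 2 * fromℕ 1) * n + fromℕ 3 ≡
    (fromℕ 5 + fromℕ 4 * t) * (fromℕ 5 + fromℕ 2 * t) * n + fromℕ 3
  factor = solve 2 (λ t n →
    (con (fromℕ 27) :+ con (fromℕ 30) :* t :+ con (fromℕ 8) :* t :* t :- con (fromℕ 2) :* con (fromℕ 1)) :* n :+ con (fromℕ 3) :=
    (con (fromℕ 5) :+ con (fromℕ 4) :* t) :* (con (fromℕ 5) :+ con (fromℕ 2) :* t) :* n :+ con (fromℕ 3)) refl
    where open +-*-Solver

theorem5p2 : ∀ (k : ℕ) (3≤k : 3 ℕ.≤ k) {N : ℕ} (D : Digraph N) →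
    Oriented D → Dicritical k D →
    let instance
          _ = 4k∸6-nonZero 3≤k
          _ = 4[2k∸3]-nonZero 3≤k
    in fromℕ (m D) ≥
         (fromℕ k - (+ 3) / 4 - (+ 1) / (4 ℕ.* k ∸ 6)) * fromℕ (n D)
           + (+ 3) / (4 ℕ.* (2 ℕ.* k ∸ 3))
theorem5p2 k 3≤k D oriented critical with ℕ.m≤n⇒∃[o]m+o≡n 3≤k
... | j , refl = rational-bound j (n D) (m D) (4 ℕ.* (3 ℕ.+ j) ∸ 6) (4 ℕ.* (2 ℕ.* (3 ℕ.+ j) ∸ 3))
  {{4k∸6-nonZero 3≤k}} {{4[2k∸3]-nonZero 3≤k}}
  (cong (_∸ 6) (ℕ.*-distribˡ-+ 4 3 j))
  (trans (cong (λ z → 4 ℕ.* (z ∸ 3)) (ℕ.*-distribˡ-+ 2 3 j)) (quadruple j))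
  (natural-bound j D oriented critical)
  where
  quadruple : ∀ j → 4 ℕ.* (3 ℕ.+ 2 ℕ.* j) ≡ 12 ℕ.+ 8 ℕ.* j
  quadruple = solve-∀
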